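{- Let $\mathcal{X}$ be a $d$-class symmetric association scheme with primitive idempotents $\{E_i\}_{i=0}^d$ (where $E_0$ is the trivial primitive idempotent). Let $B$ and $C$ be adjacency matrices of $\mathcal{X}$ with $B$ nontrivial. For $0\le i\le d$ let $\theta_i$ denote the eigenvalue of $B$ for $E_i$. Then the following are equivalent. (i) $\mathcal{X}$ is $P$-polynomial relative to $B$, and $C$ is the last adjacency matrix in this $P$-polynomial structure. (ii) $\{\theta_i\}_{i=0}^d$ are mutually distinct, and for $0\le i\le d$ the dual eigenvalue of $E_i$ for $C$ is $$\frac{(\theta_0-\theta_1)(\theta_0-\theta_2)\cdots(\theta_0-\theta_d)}{(\theta_i-\theta_0)\cdots(\theta_i-\theta_{i-1})(\theta_i-\theta_{i+1})\cdots(\theta_i-\theta_d)}.$$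
   Context: A $d$-class symmetric association scheme is a pair $\mathcal{X}=(X,\{R_i\}_{i=0}^d)$ where $X$ is a finite nonempty set and $R_0,\dots,R_d$ are nonempty subsets of $X\times X$ such that: $R_0=\{(x,x)\mid x\in X\}$; $X\times X$ is the disjoint union of $R_0,\ldots,R_d$; each $R_i$ is symmetric ($(x,y)\in R_i$ iff $(y,x)\in R_i$); and there exist integers $p^h_{ij}$ $(0\le h,i,j\le d)$, called intersection numbers, such that for every $(x,y)\in R_h$, $p^h_{ij}=|\{z\in X\mid (x,z)\in R_i,\ (z,y)\in R_j\}|$. The adjacency matrices are the real $X\times X$ matrices $A_0,\dots,A_d$ with $(A_i)_{x,y}=1$ if $(x,y)\in R_i$ and $0$ otherwise; $A_0=I$ is the trivial one. They form a basis for a commutative algebra $M$ (the Bose-Mesner algebra). $M$ has a second basis $\{E_i\}_{i=0}^d$, the primitive idempotents, with $E_0=|X|^{ -1}J$ ($J$ the all-ones matrix; $E_0$ is called trivial), $I=\sum_i E_i$, $E_i^t=E_i$, $E_iE_j=\delta_{i,j}E_i$. Define $P,Q\in\mathrm{Mat}_{d+1}(\mathbb{R})$ by $A_j=\sum_{i=0}^d P_{ij}E_i$ and $E_j=|X|^{ -1}\sum_{i=0}^d Q_{ij}A_i$ $(0\le j\le d)$. Then $P_{ij}$ is called the eigenvalue of $A_j$ for $E_i$, and $Q_{ij}$ is called the dual eigenvalue of $E_j$ for $A_i$. An ordering $\{A_i\}_{i=1}^d$ of the nontrivial adjacency matrices (with intersection numbers indexed accordingly, and $A_0=I$) is $P$-polynomial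 whenever for $0\le i,j\le d$ the intersection number $p^1_{ij}$ is zero if $|i-j|>1$ and nonzero if $|i-j|=1$. For a nontrivial adjacency matrix $A$, $\mathcal{X}$ is $P$-polynomial relative to $A$ whenever there exists a $P$-polynomial ordering $\{A_i\}_{i=1}^d$ of the nontrivial adjacency matrices with $A_1=A$; in this case $A_d$ is called the last adjacency matrix in this $P$-polynomial structure. -}

module Defs where

open import Level using (0ℓ)
open import Algebra.Bundles using (CommutativeRing)
open import Algebra.Apartness.Bundles using (HeytingField)
open import Data.Bool.Base using (if_then_else_)
open import Data.Fin.Base as Fin using (Fin; zero; suc; toℕ; fromℕ; punchIn)
import Data.Fin.Properties as Fin
open import Data.Fin.Permutation using (Permutation′; _⟨$⟩ʳ_)
import Data.Integer.Base as ℤ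
open import Data.Nat.Base as ℕ using (ℕ; zero; suc; NonZero)
import Data.Nat.Properties as ℕ
open import Data.Product.Base using (∃-syntax; _×_; _,_; proj₁; proj₂)
open import Data.Rational.Base as ℚ using (ℚ; 0ℚ; 1ℚ; ½; positive; 1/_)
import Data.Rational.Properties as ℚ
open import Data.Rational.Solver using (module +-*-Solver)
open import Data.Sum.Base using (_⊎_; inj₁; inj₂; map₁)
open import Data.Vec.Base using (count; allFin)
open import Function.Base using (_∘_)
open import Function.Bundles using (_⇔_)
open import Relation.Binary.Core using (Rel)
open import Relation.Binary.Definitions using (Decidable)
open import Relation.Binary.PropositionalEquality as ≡ using (_≡_; _≢_; refl; cong; cong₂; subst; subst₂)
open import Relation.Nullary using (¬_; Dec; yes; no; does; contradiction; _×-dec_)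
open import Relation.Nullary.Decidable using (map′)

module _ where
  open import Data.Rational.Base
    using (∣_∣; _<_; _≤_; _+_; _-_; _*_; -_; Positive; ≢-nonZero)
  open +-*-Solver

  ∣-∣-sym : ∀ a b → ∣ a - b ∣ ≡ ∣ b - a ∣
  ∣-∣-sym a b = ≡.trans (≡.sym (ℚ.∣-p∣≡∣p∣ (a - b)))
    (cong ∣_∣ (solve 2 (λ a b → :- (a :- b) := b :- a) refl a b))

  ∣-∣-triangle : ∀ a b c → ∣ a - c ∣ ≤ ∣ a - b ∣ + ∣ b - c ∣
  ∣-∣-triangle a b c = subst (λ t → ∣ t ∣ ≤ ∣ a - b ∣ + ∣ b - c ∣)
    (solve 3 (λ a b c → (a :- b) :+ (b :- c) := a :- c) refl a b c)
    (ℚ.∣p+q∣≤∣p∣+∣q∣ (a - b) (b - c))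

  p-0≡p : ∀ p → p - 0ℚ ≡ p
  p-0≡p = solve 1 (λ p → p :- con 0ℚ := p) refl

  0<1 : 0ℚ < 1ℚ
  0<1 = ℚ.positive⁻¹ 1ℚ

  0<* : ∀ {p q} → 0ℚ < p → 0ℚ < q → 0ℚ < p * q
  0<* {p} {q} 0<p 0<q = ℚ.positive⁻¹ (p * q)
    {{ℚ.pos*pos⇒pos p {{positive 0<p}} q {{positive 0<q}}}}

  half : ∀ ε → 0ℚ < ε → ∃[ δ ] 0ℚ < δ × δ + δ ≡ ε
  half ε 0<ε = ½ * ε , 0<* (ℚ.positive⁻¹ ½) 0<ε ,
    solve 1 (λ e → con ½ :* e :+ con ½ :* e := e) refl ε

  quotient : ∀ δ K → 0ℚ < δ → 0ℚ < K → ∃[ η ] 0ℚ < η × K * η ≡ δ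
  quotient δ K 0<δ 0<K = 1/ K * δ , 0<* (ℚ.positive⁻¹ (1/ K) {{ℚ.1/pos⇒pos K}}) 0<δ ,
    ≡.trans (≡.sym (ℚ.*-assoc K (1/ K) δ))
      (≡.trans (cong (_* δ) (ℚ.*-inverseʳ K)) (ℚ.*-identityˡ δ))
    where instance
      K-pos : Positive K
      K-pos = positive 0<K
      K-nz : ℚ.NonZero K
      K-nz = ℚ.pos⇒nonZero K

  ∣*∣< : ∀ {a b K η} → ∣ a ∣ < K → ∣ b ∣ < η → ∣ a * b ∣ < K * η
  ∣*∣< {a} {b} {K} {η} a<K b<η = begin-strict
    ∣ a * b ∣      ≡⟨ ℚ.∣p*q∣≡∣p∣*∣q∣ a b ⟩
    ∣ a ∣ * ∣ b ∣  ≤⟨ ℚ.*-monoʳ-≤-nonNeg ∣ b ∣ {{ℚ.∣-∣-nonNeg b}} (ℚ.<⇒≤ a<K) ⟩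
    K * ∣ b ∣      <⟨ ℚ.*-monoʳ-<-pos K {{positive 0<K}} b<η ⟩
    K * η          ∎
    where
      open ℚ.≤-Reasoning
      0<K : 0ℚ < K
      0<K = ℚ.≤-<-trans (ℚ.0≤∣p∣ a) a<K

  ≤∣*∣ : ∀ {a b ε δ} → 0ℚ < ε → 0ℚ < δ → ε ≤ ∣ a ∣ → δ ≤ ∣ b ∣ → ε * δ ≤ ∣ a * b ∣
  ≤∣*∣ {a} {b} {ε} {δ} 0<ε 0<δ ε≤a δ≤b = begin
    ε * δ          ≤⟨ ℚ.*-monoʳ-≤-nonNeg δ {{ℚ.pos⇒nonNeg δ {{positive 0<δ}}}} ε≤a ⟩
    ∣ a ∣ * δ      ≤⟨ ℚ.*-monoˡ-≤-nonNeg ∣ a ∣ {{ℚ.∣-∣-nonNeg a}} δ≤b ⟩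
    ∣ a ∣ * ∣ b ∣  ≡⟨ ℚ.∣p*q∣≡∣p∣*∣q∣ a b ⟨
    ∣ a * b ∣      ∎
    where open ℚ.≤-Reasoning

  ∣*-*∣ : ∀ a b a′ b′ → ∣ a * b - a′ * b′ ∣ ≤ ∣ a * (b - b′) ∣ + ∣ b′ * (a - a′) ∣
  ∣*-*∣ a b a′ b′ = subst (λ t → ∣ t ∣ ≤ ∣ a * (b - b′) ∣ + ∣ b′ * (a - a′) ∣)
    (solve 4 (λ a b a′ b′ → a :* (b :- b′) :+ b′ :* (a :- a′) := a :* b :- a′ :* b′) refl a b a′ b′)
    (ℚ.∣p+q∣≤∣p∣+∣q∣ (a * (b - b′)) (b′ * (a - a′)))

  ∣+-+∣ : ∀ a b a′ b′ → ∣ (a + b) - (a′ + b′) ∣ ≤ ∣ a - a′ ∣ + ∣ b - b′ ∣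
  ∣+-+∣ a b a′ b′ = subst (λ t → ∣ t ∣ ≤ ∣ a - a′ ∣ + ∣ b - b′ ∣)
    (solve 4 (λ a b a′ b′ → (a :- a′) :+ (b :- b′) := (a :+ b) :- (a′ :+ b′)) refl a b a′ b′)
    (ℚ.∣p+q∣≤∣p∣+∣q∣ (a - a′) (b - b′))

  ∣neg-neg∣ : ∀ a b → ∣ (- a) - (- b) ∣ ≡ ∣ a - b ∣
  ∣neg-neg∣ a b = ≡.trans
    (cong ∣_∣ (solve 2 (λ a b → :- a :- (:- b) := b :- a) refl a b)) (∣-∣-sym b a)

  -- The total extension of inversion by 0⁻¹ = 0.
  recip : ℚ → ℚ
  recip q with q ℚ.≟ 0ℚ
  ... | yes _   = 0ℚ
  ... | no  q≢0 = (1/ q) {{≢-nonZero q≢0}}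

  recip-inverse : ∀ {ε} q → 0ℚ < ε → ε ≤ ∣ q ∣ → q * recip q ≡ 1ℚ
  recip-inverse q 0<ε ε≤q with q ℚ.≟ 0ℚ
  ... | yes refl = contradiction (ℚ.<-≤-trans 0<ε ε≤q) (ℚ.<-irrefl refl)
  ... | no  q≢0  = ℚ.*-inverseʳ q {{≢-nonZero q≢0}}

Eventually : (ℕ → Set) → Set
Eventually P = ∃[ N ] (∀ n → N ℕ.≤ n → P n)

⊔ˡ : ∀ M N {k} → M ℕ.⊔ N ℕ.≤ k → M ℕ.≤ k
⊔ˡ M N = ℕ.m⊔n≤o⇒m≤o M N

⊔ʳ : ∀ M N {k} → M ℕ.⊔ N ℕ.≤ k → N ℕ.≤ k
⊔ʳ M N = ℕ.m⊔n≤o⇒n≤o M N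

both : ∀ {P Q R : ℕ → Set} → (∀ n → P n → Q n → R n) →
       Eventually P → Eventually Q → Eventually R
both f (M , p) (N , q) = M ℕ.⊔ N , λ n le →
  f n (p n (⊔ˡ M N le)) (q n (⊔ʳ M N le))

mapE : ∀ {P Q : ℕ → Set} → (∀ n → P n → Q n) → Eventually P → Eventually Q
mapE f (N , p) = N , λ n le → f n (p n le)

never : ∀ {P : ℕ → Set} → (∀ n → ¬ P n) → ¬ Eventually P
never f (N , p) = f N (p N ℕ.≤-refl)

IsCauchy : (ℕ → ℚ) → Set
IsCauchy s = ∀ ε → 0ℚ ℚ.< ε →
  ∃[ N ] (∀ m n → N ℕ.≤ m → N ℕ.≤ n → ℚ.∣ s m ℚ.- s n ∣ ℚ.< ε)

-- Real numbers as Cauchy sequences of rationals; equality is _≈_.  Operations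
-- are defined by copatterns so that they do not unfold during conversion.
record ℝ : Set where
  no-eta-equality
  constructor mkℝ
  field
    seq    : ℕ → ℚ
    cauchy : IsCauchy seq
open ℝ public

infix 4 _≈_ _#_

record _≈_ (x y : ℝ) : Set where
  constructor mk≈
  field
    close : ∀ ε → 0ℚ ℚ.< ε → Eventually (λ n → ℚ.∣ seq x n ℚ.- seq y n ∣ ℚ.< ε)
open _≈_ public

-- Apartness: the positive form of inequality of real numbers.
record _#_ (x y : ℝ) : Set where
  constructor mk#
  field
    gap   : ℚ
    0<gap : 0ℚ ℚ.< gap
    apart : Eventually (λ n → gap ℚ.≤ ℚ.∣ seq x n ℚ.- seq y n ∣)
open _#_ public

fromℚ : ℚ → ℝ
seq (fromℚ q) _ = q
cauchy (fromℚ q) ε 0<ε = 0 , λ _ _ _ _ →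
  subst (ℚ._< ε) (≡.sym (cong ℚ.∣_∣ (ℚ.+-inverseʳ q))) 0<ε

0ℝ 1ℝ : ℝ
0ℝ = fromℚ 0ℚ
1ℝ = fromℚ 1ℚ

module _ where
  open import Data.Rational.Base using (∣_∣)
    renaming (_<_ to _<ℚ_; _≤_ to _≤ℚ_; _+_ to _+ℚ_; _-_ to _-ℚ_; _*_ to _*ℚ_; -_ to -ℚ_)

  eventuallyBounded : ∀ x → ∃[ K ] 0ℚ <ℚ K × Eventually (λ n → ∣ seq x n ∣ <ℚ K)
  eventuallyBounded x with cauchy x 1ℚ 0<1
  ... | N , p = K , ℚ.≤-<-trans (ℚ.0≤∣p∣ (seq x N)) (bound N ℕ.≤-refl) , N , bound
    where
      K : ℚ
      K = 1ℚ +ℚ ∣ seq x N ∣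
      bound : ∀ n → N ℕ.≤ n → ∣ seq x n ∣ <ℚ K
      bound n le = ℚ.≤-<-trans
        (subst₂ (λ a b → ∣ a ∣ ≤ℚ ∣ seq x n -ℚ seq x N ∣ +ℚ ∣ b ∣) (p-0≡p _) (p-0≡p _)
          (∣-∣-triangle (seq x n) (seq x N) 0ℚ))
        (ℚ.+-monoˡ-< ∣ seq x N ∣ (p n N le ℕ.≤-refl))

  ≡⇒≈ : ∀ {x y} → (∀ n → seq x n ≡ seq y n) → x ≈ y
  ≡⇒≈ {x} {y} eq = mk≈ λ ε 0<ε → 0 , λ n _ → subst (λ a → ∣ a -ℚ seq y n ∣ <ℚ ε) (≡.sym (eq n))
    (subst (_<ℚ ε) (≡.sym (cong ∣_∣ (ℚ.+-inverseʳ (seq y n)))) 0<ε)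

  ≈-refl : ∀ {x} → x ≈ x
  ≈-refl = ≡⇒≈ λ _ → refl

  ≈-sym : ∀ {x y} → x ≈ y → y ≈ x
  ≈-sym {x} {y} p = mk≈ λ ε 0<ε →
    mapE (λ n → subst (_<ℚ ε) (∣-∣-sym (seq x n) (seq y n))) (close p ε 0<ε)

  ≈-trans : ∀ {x y z} → x ≈ y → y ≈ z → x ≈ z
  ≈-trans {x} {y} {z} p q = mk≈ λ ε 0<ε → let δ , 0<δ , δ+δ≡ε = half ε 0<ε in
    both (λ n a b → subst (∣ seq x n -ℚ seq z n ∣ <ℚ_) δ+δ≡ε
            (ℚ.≤-<-trans (∣-∣-triangle (seq x n) (seq y n) (seq z n)) (ℚ.+-mono-< a b)))
         (close p δ 0<δ) (close q δ 0<δ)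

  infixl 6 _+_
  infixl 7 _*_
  infix  8 -_

  _+_ : ℝ → ℝ → ℝ
  seq (x + y) n = seq x n +ℚ seq y n
  cauchy (x + y) ε 0<ε =
    let δ , 0<δ , δ+δ≡ε = half ε 0<ε
        M , p = cauchy x δ 0<δ
        N , q = cauchy y δ 0<δ
    in M ℕ.⊔ N , λ m n lm ln →
       subst (_ <ℚ_) δ+δ≡ε (ℚ.≤-<-trans (∣+-+∣ (seq x m) (seq y m) (seq x n) (seq y n))
         (ℚ.+-mono-< (p m n (⊔ˡ M N lm) (⊔ˡ M N ln))
                     (q m n (⊔ʳ M N lm) (⊔ʳ M N ln))))

  -_ : ℝ → ℝ
  seq (- x) n = -ℚ seq x n
  cauchy (- x) ε 0<ε = let N , p = cauchy x ε 0<ε in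
    N , λ m n lm ln → subst (_<ℚ ε) (≡.sym (∣neg-neg∣ (seq x m) (seq x n))) (p m n lm ln)

  _*_ : ℝ → ℝ → ℝ
  seq (x * y) n = seq x n *ℚ seq y n
  cauchy (x * y) ε 0<ε =
    let δ , 0<δ , δ+δ≡ε    = half ε 0<ε
        K , 0<K , N₁ , x<K = eventuallyBounded x
        L , 0<L , N₂ , y<L = eventuallyBounded y
        η , 0<η , Kη≡δ     = quotient δ K 0<δ 0<K
        κ , 0<κ , Lκ≡δ     = quotient δ L 0<δ 0<L
        N₃ , p             = cauchy y η 0<η
        N₄ , q             = cauchy x κ 0<κ
        N₁₂ = N₁ ℕ.⊔ N₂
        N₃₄ = N₃ ℕ.⊔ N₄
    in N₁₂ ℕ.⊔ N₃₄ , λ m n lm ln →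
       subst (_ <ℚ_) (≡.trans (cong₂ _+ℚ_ Kη≡δ Lκ≡δ) δ+δ≡ε)
         (ℚ.≤-<-trans (∣*-*∣ (seq x m) (seq y m) (seq x n) (seq y n))
           (ℚ.+-mono-<
             (∣*∣< {seq x m} (x<K m (⊔ˡ N₁ N₂ (⊔ˡ N₁₂ N₃₄ lm)))
                   (p m n (⊔ˡ N₃ N₄ (⊔ʳ N₁₂ N₃₄ lm)) (⊔ˡ N₃ N₄ (⊔ʳ N₁₂ N₃₄ ln))))
             (∣*∣< {seq y n} (y<L n (⊔ʳ N₁ N₂ (⊔ˡ N₁₂ N₃₄ ln)))
                   (q m n (⊔ʳ N₃ N₄ (⊔ʳ N₁₂ N₃₄ lm)) (⊔ʳ N₃ N₄ (⊔ʳ N₁₂ N₃₄ ln))))))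

  +-cong : ∀ {x x′ y y′} → x ≈ x′ → y ≈ y′ → x + y ≈ x′ + y′
  +-cong {x} {x′} {y} {y′} p q = mk≈ λ ε 0<ε → let δ , 0<δ , δ+δ≡ε = half ε 0<ε in
    both (λ n a b → subst (_ <ℚ_) δ+δ≡ε
            (ℚ.≤-<-trans (∣+-+∣ (seq x n) (seq y n) (seq x′ n) (seq y′ n)) (ℚ.+-mono-< a b)))
         (close p δ 0<δ) (close q δ 0<δ)

  -‿cong : ∀ {x y} → x ≈ y → - x ≈ - y
  -‿cong {x} {y} p = mk≈ λ ε 0<ε →
    mapE (λ n → subst (_<ℚ ε) (≡.sym (∣neg-neg∣ (seq x n) (seq y n)))) (close p ε 0<ε)

  *-cong : ∀ {x x′ y y′} → x ≈ x′ → y ≈ y′ → x * y ≈ x′ * y′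
  *-cong {x} {x′} {y} {y′} p q = mk≈ λ ε 0<ε →
    let δ , 0<δ , δ+δ≡ε = half ε 0<ε
        K , 0<K , x<K   = eventuallyBounded x
        L , 0<L , y′<L  = eventuallyBounded y′
        η , 0<η , Kη≡δ  = quotient δ K 0<δ 0<K
        κ , 0<κ , Lκ≡δ  = quotient δ L 0<δ 0<L
    in both (λ n a b → subst (_ <ℚ_) (≡.trans (cong₂ _+ℚ_ Kη≡δ Lκ≡δ) δ+δ≡ε)
               (ℚ.≤-<-trans (∣*-*∣ (seq x n) (seq y n) (seq x′ n) (seq y′ n)) (ℚ.+-mono-< a b)))
            (both (λ n → ∣*∣< {seq x n}) x<K (close q η 0<η))
            (both (λ n → ∣*∣< {seq y′ n}) y′<L (close p κ 0<κ))

  ℝ-commutativeRing : CommutativeRing 0ℓ 0ℓ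
  ℝ-commutativeRing = record
    { Carrier = ℝ ; _≈_ = _≈_ ; _+_ = _+_ ; _*_ = _*_ ; -_ = -_ ; 0# = 0ℝ ; 1# = 1ℝ
    ; isCommutativeRing = record
      { isRing = record
        { +-isAbelianGroup = record
          { isGroup = record
            { isMonoid = record
              { isSemigroup = record
                { isMagma = record
                  { isEquivalence = record { refl = ≈-refl ; sym = ≈-sym ; trans = ≈-trans }
                  ; ∙-cong = +-cong
                  }
                ; assoc = λ x y z → ≡⇒≈ λ n → ℚ.+-assoc (seq x n) (seq y n) (seq z n)
                }
              ; identity = (λ x → ≡⇒≈ λ n → ℚ.+-identityˡ (seq x n))
                         , (λ x → ≡⇒≈ λ n → ℚ.+-identityʳ (seq x n))
              }
            ; inverse = (λ x → ≡⇒≈ λ n → ℚ.+-inverseˡ (seq x n))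
                      , (λ x → ≡⇒≈ λ n → ℚ.+-inverseʳ (seq x n))
            ; ⁻¹-cong = -‿cong
            }
          ; comm = λ x y → ≡⇒≈ λ n → ℚ.+-comm (seq x n) (seq y n)
          }
        ; *-cong = *-cong
        ; *-assoc = λ x y z → ≡⇒≈ λ n → ℚ.*-assoc (seq x n) (seq y n) (seq z n)
        ; *-identity = (λ x → ≡⇒≈ λ n → ℚ.*-identityˡ (seq x n))
                     , (λ x → ≡⇒≈ λ n → ℚ.*-identityʳ (seq x n))
        ; distrib = (λ x y z → ≡⇒≈ λ n → ℚ.*-distribˡ-+ (seq x n) (seq y n) (seq z n))
                  , (λ x y z → ≡⇒≈ λ n → ℚ.*-distribʳ-+ (seq x n) (seq y n) (seq z n))
        }
      ; *-comm = λ x y → ≡⇒≈ λ n → ℚ.*-comm (seq x n) (seq y n)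
      }
    }

  infixl 6 _-_

  _-_ : ℝ → ℝ → ℝ
  x - y = x + - y

  #⇒-#0 : ∀ {x y} → x # y → x - y # 0ℝ
  #⇒-#0 (mk# ε 0<ε p) = mk# ε 0<ε (mapE (λ n → subst (λ t → ε ≤ℚ ∣ t ∣) (≡.sym (p-0≡p _))) p)

  inverse : ∀ x → x # 0ℝ → ℝ
  seq (inverse x x#0) n = recip (seq x n)
  cauchy (inverse x (mk# ε 0<ε (N₀ , p))) ε′ 0<ε′ =
    let N , q = cauchy x (ε *ℚ ε *ℚ ε′) (0<* (0<* 0<ε 0<ε) 0<ε′) in
    N₀ ℕ.⊔ N , λ m n lm ln → estimate (seq x m) (seq x n)
      (away m (⊔ˡ N₀ N lm)) (away n (⊔ˡ N₀ N ln))
      (q m n (⊔ʳ N₀ N lm) (⊔ʳ N₀ N ln))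
    where
      away : ∀ n → N₀ ℕ.≤ n → ε ≤ℚ ∣ seq x n ∣
      away n le = subst (λ t → ε ≤ℚ ∣ t ∣) (p-0≡p _) (p n le)
      εε-pos : 0ℚ <ℚ ε *ℚ ε
      εε-pos = 0<* 0<ε 0<ε
      estimate : ∀ a b {ε′} → ε ≤ℚ ∣ a ∣ → ε ≤ℚ ∣ b ∣ → ∣ a -ℚ b ∣ <ℚ ε *ℚ ε *ℚ ε′ →
                 ∣ recip a -ℚ recip b ∣ <ℚ ε′
      estimate a b {ε′} ε≤a ε≤b a-b< =
        ℚ.*-cancelˡ-<-nonNeg (ε *ℚ ε) {{ℚ.pos⇒nonNeg (ε *ℚ ε) {{positive εε-pos}}}} (begin-strict
          ε *ℚ ε *ℚ ∣ r -ℚ s ∣         ≤⟨ ℚ.*-monoʳ-≤-nonNeg ∣ r -ℚ s ∣ {{ℚ.∣-∣-nonNeg (r -ℚ s)}}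
                                           (≤∣*∣ {a} {b} 0<ε 0<ε ε≤a ε≤b) ⟩
          ∣ a *ℚ b ∣ *ℚ ∣ r -ℚ s ∣     ≡⟨ ℚ.∣p*q∣≡∣p∣*∣q∣ (a *ℚ b) (r -ℚ s) ⟨
          ∣ a *ℚ b *ℚ (r -ℚ s) ∣       ≡⟨ cong ∣_∣ (solve 4 (λ a b r s →
                                           a :* b :* (r :- s) := b :* (a :* r) :- a :* (b :* s)) refl a b r s) ⟩
          ∣ b *ℚ (a *ℚ r) -ℚ a *ℚ (b *ℚ s) ∣
                                       ≡⟨ cong₂ (λ u v → ∣ b *ℚ u -ℚ a *ℚ v ∣)
                                            (recip-inverse a 0<ε ε≤a) (recip-inverse b 0<ε ε≤b) ⟩
          ∣ b *ℚ 1ℚ -ℚ a *ℚ 1ℚ ∣       ≡⟨ cong₂ (λ u v → ∣ u -ℚ v ∣) (ℚ.*-identityʳ b) (ℚ.*-identityʳ a) ⟩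
          ∣ b -ℚ a ∣                   ≡⟨ ∣-∣-sym b a ⟩
          ∣ a -ℚ b ∣                   <⟨ a-b< ⟩
          ε *ℚ ε *ℚ ε′                 ∎)
        where
          open ℚ.≤-Reasoning
          open +-*-Solver
          r s : ℚ
          r = recip a
          s = recip b

  *-inverse : ∀ x (x#0 : x # 0ℝ) → x * inverse x x#0 ≈ 1ℝ
  *-inverse x (mk# ε 0<ε (N₀ , p)) = mk≈ λ ε′ 0<ε′ → N₀ , λ n le →
    subst (λ t → ∣ t -ℚ 1ℚ ∣ <ℚ ε′)
      (≡.sym (recip-inverse (seq x n) 0<ε (subst (λ t → ε ≤ℚ ∣ t ∣) (p-0≡p _) (p n le))))
      0<ε′

  infixl 7 _÷_[_]

  _÷_[_] : ℝ → (y : ℝ) → y # 0ℝ → ℝ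
  x ÷ y [ y#0 ] = x * inverse y y#0

  1#0 : 1ℝ # 0ℝ
  1#0 = mk# 1ℚ 0<1 (0 , λ _ _ → ℚ.≤-refl)

  *-#0 : ∀ {x y} → x # 0ℝ → y # 0ℝ → x * y # 0ℝ
  *-#0 {x} {y} (mk# ε 0<ε p) (mk# δ 0<δ q) = mk# (ε *ℚ δ) (0<* 0<ε 0<δ)
    (both (λ n a b → subst (λ t → ε *ℚ δ ≤ℚ ∣ t ∣) (≡.sym (p-0≡p _))
       (≤∣*∣ {seq x n} {seq y n} 0<ε 0<δ
         (subst (λ t → ε ≤ℚ ∣ t ∣) (p-0≡p _) a) (subst (λ t → δ ≤ℚ ∣ t ∣) (p-0≡p _) b))) p q)

  dichotomy : ∀ (z : ℕ → ℚ) N {δ η ε} → 0ℚ <ℚ δ → δ +ℚ δ ≡ η → η +ℚ η ≡ ε →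
              (∀ m n → N ℕ.≤ m → N ℕ.≤ n → ∣ z m -ℚ z n ∣ <ℚ δ) → Dec (∣ z N ∣ <ℚ η) →
              Eventually (λ n → δ ≤ℚ ∣ z n ∣) ⊎ Eventually (λ n → ∣ z n ∣ <ℚ ε)
  dichotomy z N {δ} {η} {ε} 0<δ δ+δ≡η η+η≡ε p (yes zN<η) = inj₂ (N , λ n le → begin-strict
    ∣ z n ∣                          ≡⟨ cong ∣_∣ (p-0≡p (z n)) ⟨
    ∣ z n -ℚ 0ℚ ∣                    ≤⟨ ∣-∣-triangle (z n) (z N) 0ℚ ⟩
    ∣ z n -ℚ z N ∣ +ℚ ∣ z N -ℚ 0ℚ ∣  ≡⟨ cong (λ t → ∣ z n -ℚ z N ∣ +ℚ ∣ t ∣) (p-0≡p (z N)) ⟩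
    ∣ z n -ℚ z N ∣ +ℚ ∣ z N ∣        <⟨ ℚ.+-mono-< (p n N le ℕ.≤-refl) zN<η ⟩
    δ +ℚ η                           <⟨ ℚ.+-monoˡ-< η δ<η ⟩
    η +ℚ η                           ≡⟨ η+η≡ε ⟩
    ε                                ∎)
    where
      open ℚ.≤-Reasoning
      δ<η : δ <ℚ η
      δ<η = subst₂ _<ℚ_ (ℚ.+-identityʳ δ) δ+δ≡η (ℚ.+-monoʳ-< δ 0<δ)
  dichotomy z N {δ} {η} {ε} 0<δ δ+δ≡η η+η≡ε p (no zN≮η) =
    inj₁ (N , λ n le → ℚ.≮⇒≥ λ zn<δ → ℚ.<-irrefl refl (begin-strict
      η                                ≤⟨ ℚ.≮⇒≥ zN≮η ⟩
      ∣ z N ∣                          ≡⟨ cong ∣_∣ (p-0≡p (z N)) ⟨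
      ∣ z N -ℚ 0ℚ ∣                    ≤⟨ ∣-∣-triangle (z N) (z n) 0ℚ ⟩
      ∣ z N -ℚ z n ∣ +ℚ ∣ z n -ℚ 0ℚ ∣  ≡⟨ cong (λ t → ∣ z N -ℚ z n ∣ +ℚ ∣ t ∣) (p-0≡p (z n)) ⟩
      ∣ z N -ℚ z n ∣ +ℚ ∣ z n ∣        <⟨ ℚ.+-mono-< (p N n ℕ.≤-refl le) zn<δ ⟩
      δ +ℚ δ                           ≡⟨ δ+δ≡η ⟩
      η                                ∎))
    where open ℚ.≤-Reasoning

  #-or-close : ∀ x y ε → 0ℚ <ℚ ε → x # y ⊎ Eventually (λ n → ∣ seq x n -ℚ seq y n ∣ <ℚ ε)
  #-or-close x y ε 0<ε =
    let η , 0<η , η+η≡ε = half ε 0<ε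
        δ , 0<δ , δ+δ≡η = half η 0<η
        N , p           = cauchy (x - y) δ 0<δ
    in map₁ (mk# δ 0<δ)
         (dichotomy (λ n → seq x n -ℚ seq y n) N 0<δ δ+δ≡η η+η≡ε p (∣ seq x N -ℚ seq y N ∣ ℚ.<? η))

  #-irrefl : ∀ {x y} → x ≈ y → ¬ x # y
  #-irrefl x≈y (mk# ε 0<ε p) =
    never (λ n → λ { (a , b) → ℚ.<-irrefl refl (ℚ.<-≤-trans a b) })
      (both (λ n → _,_) (close x≈y ε 0<ε) p)

  #-sym : ∀ {x y} → x # y → y # x
  #-sym {x} {y} (mk# ε 0<ε p) = mk# ε 0<ε (mapE (λ n → subst (ε ≤ℚ_) (∣-∣-sym (seq x n) (seq y n))) p)

  #-cotrans : ∀ {x y} → x # y → ∀ z → x # z ⊎ z # y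
  #-cotrans {x} {y} (mk# ε 0<ε p) z =
    let δ , 0<δ , δ+δ≡ε = half ε 0<ε in
    choose δ+δ≡ε (#-or-close x z δ 0<δ) (#-or-close z y δ 0<δ)
    where
      choose : ∀ {δ} → δ +ℚ δ ≡ ε →
               x # z ⊎ Eventually (λ n → ∣ seq x n -ℚ seq z n ∣ <ℚ δ) →
               z # y ⊎ Eventually (λ n → ∣ seq z n -ℚ seq y n ∣ <ℚ δ) → x # z ⊎ z # y
      choose _     (inj₁ x#z) _          = inj₁ x#z
      choose _     (inj₂ _)   (inj₁ z#y) = inj₂ z#y
      choose δ+δ≡ε (inj₂ a)   (inj₂ b)   = contradiction (both (λ n → _,_) p (both (λ n → _,_) a b))
        (never λ n → λ { (ε≤ , a , b) → ℚ.<-irrefl refl (ℚ.≤-<-trans ε≤ (subst (_ <ℚ_) δ+δ≡ε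
          (ℚ.≤-<-trans (∣-∣-triangle (seq x n) (seq z n) (seq y n)) (ℚ.+-mono-< a b)))) })

  #-tight : ∀ x y → ¬ x # y → x ≈ y
  #-tight x y ¬x#y = mk≈ λ ε 0<ε → case (#-or-close x y ε 0<ε)
    where
      case : ∀ {Q : Set} → x # y ⊎ Q → Q
      case (inj₁ x#y) = contradiction x#y ¬x#y
      case (inj₂ q)   = q

  invertible⇒# : ∀ {x y} w → w * (x - y) ≈ 1ℝ → x # y
  invertible⇒# {x} {y} w wz≈1 =
    let K , 0<K , w<K   = eventuallyBounded w
        h , 0<h , h+h≡1 = half 1ℚ 0<1
        η , 0<η , Kη≡h  = quotient h K 0<h 0<K
    in mk# η 0<η
    (both (λ n w<K close → ℚ.≮⇒≥ λ z<η → ℚ.<-irrefl refl (begin-strict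
        1ℚ                                    ≡⟨⟩
        ∣ 1ℚ -ℚ 0ℚ ∣                          ≤⟨ ∣-∣-triangle 1ℚ (v n) 0ℚ ⟩
        ∣ 1ℚ -ℚ v n ∣ +ℚ ∣ v n -ℚ 0ℚ ∣        ≡⟨ cong₂ (λ s t → s +ℚ ∣ t ∣) (∣-∣-sym 1ℚ (v n)) (p-0≡p (v n)) ⟩
        ∣ v n -ℚ 1ℚ ∣ +ℚ ∣ v n ∣              <⟨ ℚ.+-mono-< close
                                                  (∣*∣< {seq w n} {seq (x - y) n} w<K z<η) ⟩
        h +ℚ K *ℚ η                           ≡⟨ cong (h +ℚ_) Kη≡h ⟩
        h +ℚ h                                ≡⟨ h+h≡1 ⟩
        1ℚ                                    ∎)) w<K (close wz≈1 h 0<h))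
    where
      open ℚ.≤-Reasoning
      v : ℕ → ℚ
      v = seq (w * (x - y))

  ℝ-heytingField : HeytingField 0ℓ 0ℓ 0ℓ
  ℝ-heytingField = record
    { Carrier = ℝ ; _≈_ = _≈_ ; _#_ = _#_ ; _+_ = _+_ ; _*_ = _*_ ; -_ = -_ ; 0# = 0ℝ ; 1# = 1ℝ
    ; isHeytingField = record
      { isHeytingCommutativeRing = record
        { isCommutativeRing = CommutativeRing.isCommutativeRing ℝ-commutativeRing
        ; isApartnessRelation = record { irrefl = #-irrefl ; sym = #-sym ; cotrans = #-cotrans }
        ; #⇒invertible = λ {x} {y} x#y → let z#0 = #⇒-#0 x#y ; inv = *-inverse (x - y) z#0 in
            inverse (x - y) z#0 ,
            ≈-trans (CommutativeRing.*-comm ℝ-commutativeRing (inverse (x - y) z#0) (x - y)) inv , inv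
        ; invertible⇒# = λ { (w , wz≈1 , _) → invertible⇒# w wz≈1 }
        }
      ; tight = λ x y → #-tight x y , #-irrefl
      }
    }

open CommutativeRing ℝ-commutativeRing public
  using (semiring; *-commutativeMonoid; *-identityˡ; zeroˡ; +-identityˡ; +-identityʳ)
open import Algebra.Properties.Semiring.Sum semiring public
  using (sum; sum-cong-≋; *-distribˡ-sum)
open import Algebra.Properties.CommutativeMonoid.Sum *-commutativeMonoid public
  using () renaming (sum to product)

product-#0 : ∀ {n} (f : Fin n → ℝ) → (∀ i → f i # 0ℝ) → product f # 0ℝ
product-#0 {zero}  f f#0 = 1#0
product-#0 {suc n} f f#0 = *-#0 (f#0 zero) (product-#0 (f ∘ suc) (f#0 ∘ suc))

δ : ∀ {n} → Fin n → Fin n → ℝ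
δ i j = if does (i Fin.≟ j) then 1ℝ else 0ℝ

Matrix : ℕ → Set
Matrix n = Fin n → Fin n → ℝ

infix 4 _≈ₘ_

_≈ₘ_ : ∀ {n} → Matrix n → Matrix n → Set
M ≈ₘ N = ∀ x y → M x y ≈ N x y

infixl 7 _*ₘ_ _·ₘ_

_*ₘ_ : ∀ {n} → Matrix n → Matrix n → Matrix n
(M *ₘ N) x y = sum λ z → M x z * N z y

_·ₘ_ : ∀ {n} → ℝ → Matrix n → Matrix n
(r ·ₘ M) x y = r * M x y

transpose : ∀ {n} → Matrix n → Matrix n
transpose M x y = M y x

sumₘ : ∀ {k n} → (Fin k → Matrix n) → Matrix n
sumₘ V x y = sum λ i → V i x y

identityₘ allOnes zeroₘ : ∀ {n} → Matrix n
identityₘ   = δ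
allOnes _ _ = 1ℝ
zeroₘ _ _   = 0ℝ

combination : ∀ {k n} → (Fin k → ℝ) → (Fin k → Matrix n) → Matrix n
combination c V = sumₘ λ i → c i ·ₘ V i

_∈Span_ : ∀ {k n} → Matrix n → (Fin k → Matrix n) → Set
M ∈Span V = ∃[ c ] M ≈ₘ combination c V

record IsBasis {k n} (V : Fin k → Matrix n) (S : Matrix n → Set) : Set where
  field
    members     : ∀ i → S (V i)
    spanning    : ∀ M → S M → M ∈Span V
    independent : ∀ c → combination c V ≈ₘ zeroₘ → ∀ i → c i ≈ 0ℝ

sum-0* : ∀ {n} (f : Fin n → ℝ) → sum (λ i → 0ℝ * f i) ≈ 0ℝ
sum-0* {zero}  f = ≈-refl
sum-0* {suc n} f = ≈-trans (+-cong (zeroˡ (f zero)) (sum-0* (f ∘ suc))) (+-identityˡ 0ℝ)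

sum-δ : ∀ {n} (f : Fin n → ℝ) j → sum (λ i → δ i j * f i) ≈ f j
sum-δ f zero    = ≈-trans (+-cong (*-identityˡ (f zero)) (sum-0* (f ∘ suc))) (+-identityʳ (f zero))
sum-δ f (suc j) = ≈-trans (+-cong (zeroˡ (f zero)) (sum-δ (f ∘ suc) j)) (+-identityˡ (f (suc j)))

member∈Span : ∀ {k n} (V : Fin k → Matrix n) j → V j ∈Span V
member∈Span V j = (λ i → δ i j) , λ x y → ≈-sym (sum-δ (λ i → V i x y) j)

-- The vertex set is Fin n.
record AssociationScheme (d n : ℕ) : Set₁ where
  field
    ⦃ nonempty ⦄   : NonZero n
    R              : Fin (suc d) → Rel (Fin n) 0ℓ
    R-nonempty     : ∀ i → ∃[ x ] ∃[ y ] R i x y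
    R₀-diagonal    : ∀ x y → R zero x y ⇔ x ≡ y
    covering       : ∀ x y → ∃[ i ] R i x y
    disjoint       : ∀ {i j x y} → R i x y → R j x y → i ≡ j
    symmetric      : ∀ {i x y} → R i x y → R i y x

  R? : ∀ i → Decidable (R i)
  R? i x y = map′ (λ eq → subst (λ k → R k x y) eq (proj₂ (covering x y)))
                  (disjoint (proj₂ (covering x y))) (proj₁ (covering x y) Fin.≟ i)

  field
    -- p h i j is the intersection number with upper index h.
    p              : Fin (suc d) → Fin (suc d) → Fin (suc d) → ℕ
    p-intersection : ∀ h i j x y → R h x y →
                     p h i j ≡ count (λ z → R? i x z ×-dec R? j z y) (allFin n)

  A : Fin (suc d) → Matrix n
  A i x y = if does (R? i x y) then 1ℝ else 0ℝ

  BoseMesner : Matrix n → Set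
  BoseMesner M = M ∈Span A

  sizeℚ : ℚ
  sizeℚ = ℤ.+ n ℚ./ 1

  instance
    sizeℚ-nonZero : ℚ.NonZero sizeℚ
    sizeℚ-nonZero = ℚ.pos⇒nonZero sizeℚ {{ℚ.normalize-pos n 1}}

  ∣X∣ ∣X∣⁻¹ : ℝ
  ∣X∣   = fromℚ sizeℚ
  ∣X∣⁻¹ = fromℚ (1/ sizeℚ)

  -- An ordering A_σ₁, …, A_σd of the nontrivial adjacency matrices is encoded
  -- as a permutation σ of all d + 1 indices that fixes 0.  The indices 1 and d
  -- are addressed through toℕ and fromℕ, so that d = 0 is not excluded; for
  -- d ≥ 1 exactly one index `one` has toℕ one ≡ 1.
  record IsPPolynomialOrdering (σ : Permutation′ (suc d)) : Set where
    field
      fixes-trivial : σ ⟨$⟩ʳ zero ≡ zero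
      vanishing     : ∀ one i j → toℕ one ≡ 1 → ℕ.∣ toℕ i - toℕ j ∣ ℕ.> 1 →
                      p (σ ⟨$⟩ʳ one) (σ ⟨$⟩ʳ i) (σ ⟨$⟩ʳ j) ≡ 0
      nonvanishing  : ∀ one i j → toℕ one ≡ 1 → ℕ.∣ toℕ i - toℕ j ∣ ≡ 1 →
                      p (σ ⟨$⟩ʳ one) (σ ⟨$⟩ʳ i) (σ ⟨$⟩ʳ j) ≢ 0

  record PPolynomialRelativeTo (b : Fin (suc d)) : Set where
    field
      ordering      : Permutation′ (suc d)
      isPPolynomial : IsPPolynomialOrdering ordering
      first         : ∀ one → toℕ one ≡ 1 → ordering ⟨$⟩ʳ one ≡ b

    last : Fin (suc d)
    last = ordering ⟨$⟩ʳ fromℕ d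

-- A family of orthogonal idempotents forming a basis of the Bose-Mesner algebra;
-- the order of the nontrivial ones is arbitrary.
record PrimitiveIdempotents {d n} (𝒳 : AssociationScheme d n) : Set where
  open AssociationScheme 𝒳
  field
    E          : Fin (suc d) → Matrix n
    basis      : IsBasis E BoseMesner
    E₀-trivial : E zero ≈ₘ ∣X∣⁻¹ ·ₘ allOnes
    complete   : identityₘ ≈ₘ sumₘ E
    symmetricE : ∀ i → transpose (E i) ≈ₘ E i
    orthogonal : ∀ i j → E i *ₘ E j ≈ₘ δ i j ·ₘ E i

  open IsBasis basis public

  -- P i j, the eigenvalue of A j for E i.
  P : Fin (suc d) → Fin (suc d) → ℝ
  P i j = proj₁ (spanning (A j) (member∈Span A j)) i

  -- Q i j, the dual eigenvalue of E j for A i.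
  Q : Fin (suc d) → Fin (suc d) → ℝ
  Q i j = ∣X∣ * proj₁ (members j) i

  P-expansion : ∀ j → A j ≈ₘ sumₘ (λ i → P i j ·ₘ E i)
  P-expansion j = proj₂ (spanning (A j) (member∈Span A j))

  Q-expansion : ∀ j → E j ≈ₘ ∣X∣⁻¹ ·ₘ sumₘ (λ i → Q i j ·ₘ A i)
  Q-expansion j x y = ≈-trans (proj₂ (members j) x y) (≈-sym
    (≈-trans (*-distribˡ-sum ∣X∣⁻¹ (λ i → Q i j * A i x y))
      (sum-cong-≋ λ i → cancel (proj₁ (members j) i) (A i x y))))
    where
      cancel : ∀ c a → ∣X∣⁻¹ * (∣X∣ * c * a) ≈ c * a
      cancel c a = ≡⇒≈ λ k → ≡.trans
        (solve 4 (λ m⁻¹ m c a → m⁻¹ :* (m :* c :* a) := (m⁻¹ :* m) :* (c :* a)) refl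
          (1/ sizeℚ) sizeℚ (seq c k) (seq a k))
        (≡.trans (cong (ℚ._* (seq c k ℚ.* seq a k)) (ℚ.*-inverseˡ sizeℚ))
          (ℚ.*-identityˡ (seq c k ℚ.* seq a k)))
        where open +-*-Solver

-- Distinctness of reals is apartness (classically equivalent to ¬ (θ i ≈ θ j)),
-- the form that permits division.
MutuallyDistinct : ∀ {k} → (Fin k → ℝ) → Set
MutuallyDistinct θ = ∀ i j → i ≢ j → θ i # θ j

numerator : ∀ {d} → (Fin (suc d) → ℝ) → ℝ
numerator θ = product λ j → θ zero - θ (suc j)

-- punchIn i enumerates the indices other than i in increasing order.
denominator : ∀ {d} → (Fin (suc d) → ℝ) → Fin (suc d) → ℝ
denominator θ i = product λ j → θ i - θ (punchIn i j)

denominator-#0 : ∀ {d} (θ : Fin (suc d) → ℝ) → MutuallyDistinct θ → ∀ i → denominator θ i # 0ℝ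
denominator-#0 θ distinct i = product-#0 (λ j → θ i - θ (punchIn i j)) λ j →
  #⇒-#0 (distinct i (punchIn i j) (λ eq → Fin.punchInᵢ≢i i j (≡.sym eq)))

{-# OPTIONS --safe #-}

-- Everything is expressed through the identity θₖ Pₖₕ = Σⱼ pʲ_bh Pₖⱼ, where
-- θₖ = Pₖ_b, and the orthogonality relations between P and Q.
--
-- (i) ⇒ (ii).  Along a P-polynomial ordering each P_{i,σm} is a polynomial in
-- θᵢ, so θᵢ - θⱼ divides P_{i,h} - P_{j,h} for all h, and then divides 1 by
-- orthogonality: θᵢ and θⱼ are apart.  The product Π_{j≠i} (B - θⱼ I), which is
-- denominatorᵢ · Eᵢ, is a monic polynomial of degree d in B, so its coefficient
-- at C = A_σd does not depend on i.  Hence Q_{ci} · denominatorᵢ is constant,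
-- and for i = 0 it is the numerator.
--
-- (ii) ⇒ (i).  The number of B-walks of length m from the trivial relation to c
-- is |X|⁻¹ Σₖ Q_{ck} θₖᵐ.  With the given Q_{ck} this sum is a divided
-- difference of xᵐ at θ₀, …, θ_d, so it vanishes for m < d but not for m = d.
-- A walk of length d is therefore a geodesic through all d + 1 relations, and
-- its vertices are the P-polynomial ordering.
module Submission where

open import Defs
open import Algebra.Bundles using (CommutativeRing)
import Algebra.Solver.Ring as RingSolver
open import Algebra.Solver.Ring.AlmostCommutativeRing using (_-Raw-AlmostCommutative⟶_; fromCommutativeRing)
open import Data.Bool.Base using (Bool; true; false; _∧_; if_then_else_)
open import Data.Fin.Base using (Fin; zero; suc; toℕ; fromℕ; fromℕ<; inject₁; punchIn; punchOut)
open import Data.Fin.Permutation using (Permutation′; permutation; _⟨$⟩ʳ_; _⟨$⟩ˡ_; inverseˡ; inverseʳ)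
import Data.Fin.Properties as Fin
open import Data.Maybe.Base as Maybe using ()
open import Data.Nat.Base as ℕ using (ℕ; zero; suc)
import Data.Nat.Properties as ℕ
open import Data.Product.Base using (Σ-syntax; ∃-syntax; _×_; _,_; proj₁; proj₂)
import Data.Rational.Base as ℚ
import Data.Rational.Properties as ℚ
open import Data.Sum.Base using (_⊎_; inj₁; inj₂; [_,_]′)
open import Data.Vec.Base using (count; tabulate)
open import Function.Base using (_∘_; id)
open import Function.Bundles using (_⇔_; mk⇔; Equivalence)
open import Function.Definitions using (Injective)
open import Level using (0ℓ)
open import Relation.Binary.Definitions using (tri<; tri≈; tri>)
open import Relation.Binary.PropositionalEquality as ≡ using (_≡_; _≢_; refl; cong; subst)
open import Relation.Nullary using (¬_; yes; no; does; contradiction; _×-dec_)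
open import Relation.Nullary.Decidable using (dec⇒maybe; dec-true; dec-false; decidable-stable; does-⇔)
open import Relation.Unary using (Pred; Decidable)

open CommutativeRing ℝ-commutativeRing
  using (setoid; +-congˡ; +-congʳ; *-congˡ; *-congʳ; *-identityʳ; zeroʳ; *-assoc; *-comm; -‿inverseʳ;
         *-commutativeSemigroup)
open import Algebra.Properties.CommutativeSemigroup *-commutativeSemigroup using (x∙yz≈y∙xz; x∙yz≈xz∙y)
open import Algebra.Properties.Semiring.Divisibility semiring using (_∣_; _,_; _∣0; ∣-respʳ; x∣ʳy⇒x∣ʳzy)
open import Algebra.Properties.Semiring.Exp semiring using (_^_)
open import Algebra.Properties.Semiring.Mult semiring using (×-homo-+; ×1-homo-*) renaming (_×_ to _×ᴿ_)
open import Algebra.Properties.Semiring.Sum semiring using (∑-comm; ∑-distrib-+; *-distribʳ-sum; sum-remove)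
import Algebra.Properties.Semiring.Sum ℕ.+-*-semiring as ℕΣ
open import Relation.Binary.Reasoning.Setoid setoid

-- Ring solving, finite sums and matrix algebra over ℝ.

-- Coefficients are taken in ℚ, where equality is decidable, so that the solver can cancel constants
-- although equality on ℝ is not decidable.
fromℚ-homomorphism : ℚ.+-*-rawRing -Raw-AlmostCommutative⟶ fromCommutativeRing ℝ-commutativeRing
fromℚ-homomorphism = record
  { ⟦_⟧    = fromℚ
  ; +-homo = λ _ _ → ≡⇒≈ λ _ → refl
  ; *-homo = λ _ _ → ≡⇒≈ λ _ → refl
  ; -‿homo = λ _ → ≡⇒≈ λ _ → refl
  ; 0-homo = ≈-refl
  ; 1-homo = ≈-refl
  }

open RingSolver ℚ.+-*-rawRing (fromCommutativeRing ℝ-commutativeRing) fromℚ-homomorphism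
  (λ p q → Maybe.map (λ p≡q → ≡⇒≈ λ _ → p≡q) (dec⇒maybe (p ℚ.≟ q)))
  using (solve; _:=_; con; _:+_; _:*_; _:-_; :-_)

δ-refl : ∀ {n} (i : Fin n) → δ i i ≡ 1ℝ
δ-refl i rewrite dec-true (i Fin.≟ i) refl = refl

δ-≢ : ∀ {n} {i j : Fin n} → i ≢ j → δ i j ≡ 0ℝ
δ-≢ {i = i} {j} i≢j rewrite dec-false (i Fin.≟ j) i≢j = refl

sum-zero : ∀ {n} (t : Fin n → ℝ) → (∀ k → t k ≈ 0ℝ) → sum t ≈ 0ℝ
sum-zero {zero}  t t≈0 = ≈-refl
sum-zero {suc n} t t≈0 =
  ≈-trans (+-cong (t≈0 zero) (sum-zero (t ∘ suc) (t≈0 ∘ suc))) (+-identityˡ 0ℝ)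

sum-single : ∀ {n} (t : Fin n → ℝ) i → (∀ k → k ≢ i → t k ≈ 0ℝ) → sum t ≈ t i
sum-single {suc n} t i t≈0 = begin
  sum t                                ≈⟨ sum-remove {i = i} t ⟩
  t i + sum (λ k → t (punchIn i k))    ≈⟨ +-congˡ (sum-zero _ λ k → t≈0 _ (Fin.punchInᵢ≢i i k)) ⟩
  t i + 0ℝ                             ≈⟨ +-identityʳ (t i) ⟩
  t i                                  ∎

sum-*δ : ∀ {n} (c : Fin n → ℝ) i → sum (λ k → c k * δ i k) ≈ c i
sum-*δ c i = begin
  sum (λ k → c k * δ i k)  ≈⟨ sum-single _ i (λ k k≢i → ≈-trans
                                (*-congˡ (≡⇒≈ λ n → cong (λ r → seq r n) (δ-≢ (k≢i ∘ ≡.sym)))) (zeroʳ (c k))) ⟩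
  c i * δ i i              ≡⟨ cong (c i *_) (δ-refl i) ⟩
  c i * 1ℝ                 ≈⟨ *-identityʳ (c i) ⟩
  c i                      ∎

sum-difference : ∀ {n} (f g : Fin n → ℝ) → sum (λ i → f i - g i) ≈ sum f - sum g
sum-difference {zero}  f g = ≈-sym (-‿inverseʳ 0ℝ)
sum-difference {suc n} f g = ≈-trans (+-congˡ (sum-difference (f ∘ suc) (g ∘ suc)))
  (solve 4 (λ a b s t → (a :- b) :+ (s :- t) := (a :+ s) :- (b :+ t)) ≈-refl
    (f zero) (g zero) (sum (f ∘ suc)) (sum (g ∘ suc)))

combination-congʳ : ∀ {k n} (c : Fin k → ℝ) {V V′ : Fin k → Matrix n} →
                    (∀ i → V i ≈ₘ V′ i) → combination c V ≈ₘ combination c V′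
combination-congʳ c eq x y = sum-cong-≋ λ i → *-congˡ (eq i x y)

combination-combination : ∀ {k l n} (c : Fin k → ℝ) (C : Fin k → Fin l → ℝ) (V : Fin l → Matrix n) →
  combination c (λ i → combination (C i) V) ≈ₘ combination (λ j → sum λ i → c i * C i j) V
combination-combination c C V x y = begin
  sum (λ i → c i * sum (λ j → C i j * V j x y))
    ≈⟨ sum-cong-≋ (λ i → *-distribˡ-sum (c i) (λ j → C i j * V j x y)) ⟩
  sum (λ i → sum (λ j → c i * (C i j * V j x y)))
    ≈⟨ ∑-comm (λ i j → c i * (C i j * V j x y)) ⟩
  sum (λ j → sum (λ i → c i * (C i j * V j x y)))
    ≈⟨ sum-cong-≋ (λ j → ≈-trans (sum-cong-≋ λ i → ≈-sym (*-assoc (c i) (C i j) (V j x y)))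
         (≈-sym (*-distribʳ-sum (V j x y) (λ i → c i * C i j)))) ⟩
  sum (λ j → sum (λ i → c i * C i j) * V j x y) ∎

*ₘ-congˡ : ∀ {n} {M N : Matrix n} (L : Matrix n) → M ≈ₘ N → L *ₘ M ≈ₘ L *ₘ N
*ₘ-congˡ L eq x y = sum-cong-≋ λ z → *-congˡ (eq z y)

*ₘ-congʳ : ∀ {n} {M N : Matrix n} (L : Matrix n) → M ≈ₘ N → M *ₘ L ≈ₘ N *ₘ L
*ₘ-congʳ L eq x y = sum-cong-≋ λ z → *-congʳ (eq x z)

*ₘ-combination : ∀ {k n} (M : Matrix n) (c : Fin k → ℝ) (V : Fin k → Matrix n) →
  M *ₘ combination c V ≈ₘ combination c (λ i → M *ₘ V i)
*ₘ-combination M c V x y = begin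
  sum (λ z → M x z * sum (λ i → c i * V i z y))
    ≈⟨ sum-cong-≋ (λ z → *-distribˡ-sum (M x z) (λ i → c i * V i z y)) ⟩
  sum (λ z → sum (λ i → M x z * (c i * V i z y)))
    ≈⟨ ∑-comm (λ z i → M x z * (c i * V i z y)) ⟩
  sum (λ i → sum (λ z → M x z * (c i * V i z y)))
    ≈⟨ sum-cong-≋ (λ i → ≈-trans (sum-cong-≋ λ z → x∙yz≈y∙xz (M x z) (c i) (V i z y))
         (≈-sym (*-distribˡ-sum (c i) (λ z → M x z * V i z y)))) ⟩
  sum (λ i → c i * sum (λ z → M x z * V i z y)) ∎

combination-*ₘ : ∀ {k n} (c : Fin k → ℝ) (V : Fin k → Matrix n) (M : Matrix n) →
  combination c V *ₘ M ≈ₘ combination c (λ i → V i *ₘ M)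
combination-*ₘ c V M x y = begin
  sum (λ z → sum (λ i → c i * V i x z) * M z y)
    ≈⟨ sum-cong-≋ (λ z → *-distribʳ-sum (M z y) (λ i → c i * V i x z)) ⟩
  sum (λ z → sum (λ i → c i * V i x z * M z y))
    ≈⟨ ∑-comm (λ z i → c i * V i x z * M z y) ⟩
  sum (λ i → sum (λ z → c i * V i x z * M z y))
    ≈⟨ sum-cong-≋ (λ i → ≈-trans (sum-cong-≋ λ z → *-assoc (c i) (V i x z) (M z y))
         (≈-sym (*-distribˡ-sum (c i) (λ z → V i x z * M z y)))) ⟩
  sum (λ i → c i * sum (λ z → V i x z * M z y)) ∎

-- Natural numbers and counts inside ℝ.

ι : ℕ → ℝ
ι m = m ×ᴿ 1ℝ

seq-ι-nonNeg : ∀ m n → ℚ.0ℚ ℚ.≤ seq (ι m) n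
seq-ι-nonNeg zero    n = ℚ.≤-refl
seq-ι-nonNeg (suc m) n = ℚ.+-mono-≤ (ℚ.<⇒≤ 0<1) (seq-ι-nonNeg m n)

-- Every term of the sequence of `ι (suc m)` is at least 1, so 1 serves as the gap.
ι-#0 : ∀ {m} → m ≢ 0 → ι m # 0ℝ
ι-#0 {zero}  m≢0 = contradiction refl m≢0
ι-#0 {suc m} _   = mk# ℚ.1ℚ 0<1 (0 , λ n _ →
  subst (ℚ.1ℚ ℚ.≤_)
    (≡.sym (≡.trans (cong ℚ.∣_∣ (p-0≡p _)) (ℚ.0≤p⇒∣p∣≡p (seq-ι-nonNeg (suc m) n))))
    (ℚ.+-monoʳ-≤ ℚ.1ℚ (seq-ι-nonNeg m n)))

indicator : Bool → ℝ
indicator t = if t then 1ℝ else 0ℝ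

indicator-∧ : ∀ s t → indicator s * indicator t ≈ indicator (s ∧ t)
indicator-∧ true  t = *-identityˡ (indicator t)
indicator-∧ false t = zeroˡ (indicator t)

module _ {A : Set} {S : Pred A 0ℓ} (S? : Decidable S) where

  sum-indicator : ∀ {m} (f : Fin m → A) →
                  sum (λ z → indicator (does (S? (f z)))) ≈ ι (count S? (tabulate f))
  sum-indicator {zero}  f = ≈-refl
  sum-indicator {suc m} f with does (S? (f zero))
  ... | true  = +-congˡ (sum-indicator (f ∘ suc))
  ... | false = ≈-trans (+-identityˡ _) (sum-indicator (f ∘ suc))

  count≢0⇒∃ : ∀ {m} (f : Fin m → A) → count S? (tabulate f) ≢ 0 → ∃[ z ] S (f z)
  count≢0⇒∃ {zero}  f ≢0 = contradiction refl ≢0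
  count≢0⇒∃ {suc m} f ≢0 with S? (f zero)
  ... | yes s = zero , s
  ... | no  _ = let z , s = count≢0⇒∃ (f ∘ suc) ≢0 in suc z , s

  ∃⇒count≢0 : ∀ {m} (f : Fin m → A) z → S (f z) → count S? (tabulate f) ≢ 0
  ∃⇒count≢0 {suc m} f z s ≡0 with S? (f zero)
  ∃⇒count≢0 {suc m} f z       s ()  | yes _
  ∃⇒count≢0 {suc m} f zero    s _  | no ¬s = ¬s s
  ∃⇒count≢0 {suc m} f (suc z) s ≡0 | no _  = ∃⇒count≢0 (f ∘ suc) z s ≡0

-- Divided differences.

*-cancel-#0 : ∀ {x y} → x # 0ℝ → x * y ≈ 0ℝ → y ≈ 0ℝ
*-cancel-#0 {x} {y} x#0 xy≈0 = begin
  y                        ≈⟨ *-identityˡ y ⟨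
  1ℝ * y                   ≈⟨ *-congʳ (*-inverse x x#0) ⟨
  x * inverse x x#0 * y    ≈⟨ solve 3 (λ x i y → x :* i :* y := i :* (x :* y)) ≈-refl x (inverse x x#0) y ⟩
  inverse x x#0 * (x * y)  ≈⟨ *-congˡ xy≈0 ⟩
  inverse x x#0 * 0ℝ       ≈⟨ zeroʳ (inverse x x#0) ⟩
  0ℝ                       ∎

-- The factor `x i - a` splits as `(b - a) + (x i - b)`, which trades the node `a` for the node `b`.
sum-shift : ∀ {n} (g x : Fin n → ℝ) a b →
            sum (λ i → g i * (x i - a)) ≈ (b - a) * sum g + sum (λ i → g i * (x i - b))
sum-shift g x a b = begin
  sum (λ i → g i * (x i - a))
    ≈⟨ sum-cong-≋ (λ i → solve 4 (λ g x a b → g :* (x :- a) := (b :- a) :* g :+ g :* (x :- b)) ≈-refl (g i) (x i) a b) ⟩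
  sum (λ i → (b - a) * g i + g i * (x i - b))
    ≈⟨ ∑-distrib-+ (λ i → (b - a) * g i) (λ i → g i * (x i - b)) ⟩
  sum (λ i → (b - a) * g i) + sum (λ i → g i * (x i - b))
    ≈⟨ +-congʳ (≈-sym (*-distribˡ-sum (b - a) g)) ⟩
  (b - a) * sum g + sum (λ i → g i * (x i - b)) ∎

-- Dropping the node of index 1 removes one factor. For `i = zero` that factor heads the product and
-- both sides agree by computation; otherwise it stands behind the factor of the node of index 0 and
-- has to be moved.
denominator-without₁ : ∀ {n} (x : Fin (suc (suc n)) → ℝ) i → let i′ = punchIn (suc zero) i in
  (x i′ - x (suc zero)) * denominator (x ∘ punchIn (suc zero)) i ≈ denominator x i′
denominator-without₁ {n}     x zero    = ≈-refl
denominator-without₁ {suc n} x (suc i) =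
  solve 3 (λ a b D → a :* (b :* D) := b :* (a :* D)) ≈-refl
    (x i″ - x (suc zero)) (x i″ - x zero) (product λ j → x i″ - x (suc (suc (punchIn i j))))
  where
    i″ : Fin (suc (suc (suc n)))
    i″ = suc (suc i)

-- Multiplying the weights by x i - x₀ or x i - x₁ drops the node x₀ or x₁
-- without changing N, and the two resulting sums differ by (x₁ - x₀) times the
-- original one.
divided-difference : ∀ n (x w : Fin (suc n) → ℝ) N → MutuallyDistinct x →
  (∀ i → w i * denominator x i ≈ N) →
  (∀ m → m ℕ.< n → sum (λ i → w i * x i ^ m) ≈ 0ℝ) × sum (λ i → w i * x i ^ n) ≈ N
divided-difference zero x w N distinct weights =
  (λ _ ()) , ≈-trans (+-identityʳ (w zero * 1ℝ)) (weights zero)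
divided-difference (suc n) x w N distinct weights = vanish , top
  where
    x₀ x₁ : ℝ
    x₀ = x zero
    x₁ = x (suc zero)

    without₁ : Fin (suc n) → Fin (suc (suc n))
    without₁ = punchIn (suc zero)

    w₀ w₁ : Fin (suc n) → ℝ
    w₀ i = w (suc i) * (x (suc i) - x₀)
    w₁ i = w (without₁ i) * (x (without₁ i) - x₁)

    -- `punchIn (suc i)` lists index 0 first, so the factor of `x₀` already heads the denominator
    -- and reassociation suffices.
    weights₀ : ∀ i → w₀ i * denominator (x ∘ suc) i ≈ N
    weights₀ i = ≈-trans (*-assoc (w (suc i)) (x (suc i) - x₀) (denominator (x ∘ suc) i)) (weights (suc i))

    weights₁ : ∀ i → w₁ i * denominator (x ∘ without₁) i ≈ N
    weights₁ i = ≈-trans (*-assoc (w (without₁ i)) (x (without₁ i) - x₁) (denominator (x ∘ without₁) i))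
      (≈-trans (*-congˡ (denominator-without₁ x i)) (weights (without₁ i)))

    IH₀ : (∀ m → m ℕ.< n → sum (λ i → w₀ i * x (suc i) ^ m) ≈ 0ℝ) × sum (λ i → w₀ i * x (suc i) ^ n) ≈ N
    IH₀ = divided-difference n (x ∘ suc) w₀ N (λ i j i≢j → distinct (suc i) (suc j) (i≢j ∘ Fin.suc-injective)) weights₀

    IH₁ : (∀ m → m ℕ.< n → sum (λ i → w₁ i * x (without₁ i) ^ m) ≈ 0ℝ) × sum (λ i → w₁ i * x (without₁ i) ^ n) ≈ N
    IH₁ = divided-difference n (x ∘ without₁) w₁ N
      (λ i j i≢j → distinct (without₁ i) (without₁ j) (i≢j ∘ Fin.punchIn-injective (suc zero) i j)) weights₁

    move : ∀ w y h → w * y * h ≈ w * h * y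
    move = solve 3 (λ w y h → w :* y :* h := w :* h :* y) ≈-refl

    recurrence : ∀ m → sum (λ i → w₀ i * x (suc i) ^ m) ≈
                 (x₁ - x₀) * sum (λ i → w i * x i ^ m) + sum (λ i → w₁ i * x (without₁ i) ^ m)
    recurrence m = begin
      sum (λ i → w₀ i * x (suc i) ^ m)
        ≈⟨ sum-cong-≋ (λ i → move (w (suc i)) (x (suc i) - x₀) (x (suc i) ^ m)) ⟩
      g (suc zero) * (x₁ - x₀) + sum (λ i → g (suc (suc i)) * (x (suc (suc i)) - x₀))
        ≈⟨ +-congˡ (sum-shift (λ i → g (suc (suc i))) (λ i → x (suc (suc i))) x₀ x₁) ⟩
      g (suc zero) * (x₁ - x₀) + ((x₁ - x₀) * sum (λ i → g (suc (suc i))) + rest)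
        -- The term `g₀` enters both summands, as `(x₁ - x₀) * g₀` and as `g₀ * (x₀ - x₁)`, and
        -- cancels.
        ≈⟨ solve 6 (λ g₀ g₁ x₀ x₁ S r → g₁ :* (x₁ :- x₀) :+ ((x₁ :- x₀) :* S :+ r) :=
             (x₁ :- x₀) :* (g₀ :+ (g₁ :+ S)) :+ (g₀ :* (x₀ :- x₁) :+ r)) ≈-refl
             (g zero) (g (suc zero)) x₀ x₁ (sum (λ i → g (suc (suc i)))) rest ⟩
      (x₁ - x₀) * sum g + sum (λ i → g (without₁ i) * (x (without₁ i) - x₁))
        ≈⟨ +-congˡ (sum-cong-≋ (λ i → move (w (without₁ i)) (x (without₁ i) - x₁) (x (without₁ i) ^ m))) ⟨
      (x₁ - x₀) * sum g + sum (λ i → w₁ i * x (without₁ i) ^ m) ∎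
      where
        g : Fin (suc (suc n)) → ℝ
        g i = w i * x i ^ m
        rest : ℝ
        rest = sum (λ i → g (suc (suc i)) * (x (suc (suc i)) - x₁))

    -- At `m = n` both smaller families give the same `N`; this extends the vanishing by one degree.
    agree : ∀ m → m ℕ.< suc n → sum (λ i → w₀ i * x (suc i) ^ m) ≈ sum (λ i → w₁ i * x (without₁ i) ^ m)
    agree m m<1+n with ℕ.m<1+n⇒m<n∨m≡n m<1+n
    ... | inj₁ m<n  = ≈-trans (proj₁ IH₀ m m<n) (≈-sym (proj₁ IH₁ m m<n))
    ... | inj₂ refl = ≈-trans (proj₂ IH₀) (≈-sym (proj₂ IH₁))

    vanish : ∀ m → m ℕ.< suc n → sum (λ i → w i * x i ^ m) ≈ 0ℝ
    vanish m m<1+n = *-cancel-#0 (#⇒-#0 (distinct (suc zero) zero λ ())) (begin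
      (x₁ - x₀) * S          ≈⟨ solve 2 (λ s u → s := s :+ u :- u) ≈-refl ((x₁ - x₀) * S) U ⟩
      (x₁ - x₀) * S + U - U  ≈⟨ +-congʳ (≈-trans (≈-sym (recurrence m)) (agree m m<1+n)) ⟩
      U - U                  ≈⟨ -‿inverseʳ U ⟩
      0ℝ                     ∎)
      where
        S U : ℝ
        S = sum (λ i → w i * x i ^ m)
        U = sum (λ i → w₁ i * x (without₁ i) ^ m)

    top : sum (λ i → w i * x i ^ suc n) ≈ N
    top = begin
      sum (λ i → w i * (x i * x i ^ n))
        -- Reading `x i` as `x i - 0` makes `sum-shift` applicable. Replacing 0 by `x₀` costs a
        -- multiple of the moment of degree `n`, which vanishes, and leaves the family without `x₀`.
        ≈⟨ sum-cong-≋ (λ i → solve 3 (λ w x h → w :* (x :* h) := w :* h :* (x :- con ℚ.0ℚ)) ≈-refl (w i) (x i) (x i ^ n)) ⟩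
      sum (λ i → w i * x i ^ n * (x i - 0ℝ))
        ≈⟨ sum-shift (λ i → w i * x i ^ n) x 0ℝ x₀ ⟩
      (x₀ - 0ℝ) * sum (λ i → w i * x i ^ n) + sum (λ i → w i * x i ^ n * (x i - x₀))
        ≈⟨ +-cong (*-congˡ (vanish n ℕ.≤-refl))
             (+-congˡ (sum-cong-≋ λ i → ≈-sym (move (w (suc i)) (x (suc i) - x₀) (x (suc i) ^ n)))) ⟩
      (x₀ - 0ℝ) * 0ℝ + (w zero * x₀ ^ n * (x₀ - x₀) + sum (λ i → w₀ i * x (suc i) ^ n))
        ≈⟨ solve 3 (λ x g s → (x :- con ℚ.0ℚ) :* con ℚ.0ℚ :+ (g :* (x :- x) :+ s) := s) ≈-refl
             x₀ (w zero * x₀ ^ n) (sum (λ i → w₀ i * x (suc i) ^ n)) ⟩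
      sum (λ i → w₀ i * x (suc i) ^ n)
        ≈⟨ proj₂ IH₀ ⟩
      N ∎

-- Divisibility in ℝ.

ι≡0-* : ∀ {m} → m ≡ 0 → ∀ x → ι m * x ≈ 0ℝ
ι≡0-* refl = zeroˡ

≈0⇒∣ : ∀ {x y} → y ≈ 0ℝ → x ∣ y
≈0⇒∣ {x} y≈0 = ∣-respʳ (≈-sym y≈0) (x ∣0)

∣-+ : ∀ {x y z} → x ∣ y → x ∣ z → x ∣ y + z
∣-+ {x} (u , ux≈y) (v , vx≈z) = u + v ,
  ≈-trans (solve 3 (λ u v x → (u :+ v) :* x := u :* x :+ v :* x) ≈-refl u v x) (+-cong ux≈y vx≈z)

∣-- : ∀ {x y z} → x ∣ y → x ∣ z → x ∣ y - z
∣-- {x} (u , ux≈y) (v , vx≈z) = u - v ,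
  ≈-trans (solve 3 (λ u v x → (u :- v) :* x := u :* x :- v :* x) ≈-refl u v x) (+-cong ux≈y (-‿cong vx≈z))

∣-sum : ∀ {n x} (t : Fin n → ℝ) → (∀ k → x ∣ t k) → x ∣ sum t
∣-sum {zero}  t x∣t = _ ∣0
∣-sum {suc n} t x∣t = ∣-+ (x∣t zero) (∣-sum (t ∘ suc) (x∣t ∘ suc))

-- The term is the sum minus the remaining terms.
∣-sum⇒∣-term : ∀ {n x} (t : Fin n → ℝ) i → x ∣ sum t → (∀ k → k ≢ i → x ∣ t k) → x ∣ t i
∣-sum⇒∣-term {suc n} {x} t i x∣sum x∣t = ∣-respʳ
  (begin
    sum t - rest       ≈⟨ +-congʳ (sum-remove {i = i} t) ⟩
    t i + rest - rest  ≈⟨ solve 2 (λ a r → a :+ r :- r := a) ≈-refl (t i) rest ⟩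
    t i                ∎)
  (∣-- x∣sum (∣-sum (λ k → t (punchIn i k)) λ k → x∣t _ (Fin.punchInᵢ≢i i k)))
  where
    rest : ℝ
    rest = sum (λ k → t (punchIn i k))

∣-cancel-#0 : ∀ {x y z} → y # 0ℝ → x ∣ y * z → x ∣ z
∣-cancel-#0 {x} {y} {z} y#0 x∣yz = ∣-respʳ
  (begin
    inverse y y#0 * (y * z)  ≈⟨ solve 3 (λ i y z → i :* (y :* z) := y :* i :* z) ≈-refl (inverse y y#0) y z ⟩
    y * inverse y y#0 * z    ≈⟨ *-congʳ (*-inverse y y#0) ⟩
    1ℝ * z                   ≈⟨ *-identityˡ z ⟩
    z                        ∎)
  (x∣ʳy⇒x∣ʳzy (inverse y y#0) x∣yz)

-- A divisor of 1 is invertible, and apartness amounts to invertibility of the difference.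
-- Distinctness of eigenvalues is thereby reduced to algebra.
-∣1⇒# : ∀ {x y} → x - y ∣ 1ℝ → x # y
-∣1⇒# (w , w[x-y]≈1) = invertible⇒# w w[x-y]≈1

product-zero : ∀ {n} (f : Fin n → ℝ) i → f i ≈ 0ℝ → product f ≈ 0ℝ
product-zero f zero    f≈0 = ≈-trans (*-congʳ f≈0) (zeroˡ _)
product-zero f (suc i) f≈0 = ≈-trans (*-congˡ (product-zero (f ∘ suc) i f≈0)) (zeroʳ _)

-- Sums and distances of natural numbers, and permutations of `Fin n`.

ι-sum : ∀ {n} (t : Fin n → ℕ) → ι (ℕΣ.sum t) ≈ sum (ι ∘ t)
ι-sum {zero}  t = ≈-refl
ι-sum {suc n} t = ≈-trans (×-homo-+ 1ℝ (t zero) (ℕΣ.sum (t ∘ suc))) (+-congˡ (ι-sum (t ∘ suc)))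

sum≢0⇒∃ : ∀ {n} (t : Fin n → ℕ) → ℕΣ.sum t ≢ 0 → ∃[ i ] t i ≢ 0
sum≢0⇒∃ {zero}  t ≢0 = contradiction refl ≢0
sum≢0⇒∃ {suc n} t ≢0 with t zero ℕ.≟ 0
... | no  t₀≢0 = zero , t₀≢0
... | yes t₀≡0 = let i , tᵢ≢0 = sum≢0⇒∃ (t ∘ suc) (≢0 ∘ ≡.cong₂ ℕ._+_ t₀≡0) in suc i , tᵢ≢0

∃⇒sum≢0 : ∀ {n} (t : Fin n → ℕ) i → t i ≢ 0 → ℕΣ.sum t ≢ 0
∃⇒sum≢0 t zero    tᵢ≢0 = tᵢ≢0 ∘ ℕ.m+n≡0⇒m≡0 (t zero)
∃⇒sum≢0 t (suc i) tᵢ≢0 = ∃⇒sum≢0 (t ∘ suc) i tᵢ≢0 ∘ ℕ.m+n≡0⇒n≡0 (t zero)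

∣-∣≡1⇒ : ∀ m n → ℕ.∣ m - n ∣ ≡ 1 → suc m ≡ n ⊎ suc n ≡ m
∣-∣≡1⇒ zero    n       eq = inj₁ (≡.sym eq)
∣-∣≡1⇒ (suc m) zero    eq = inj₂ (≡.sym eq)
∣-∣≡1⇒ (suc m) (suc n) eq with ∣-∣≡1⇒ m n eq
... | inj₁ p = inj₁ (cong suc p)
... | inj₂ p = inj₂ (cong suc p)

∣-∣>1⇒ : ∀ m n → ℕ.∣ m - n ∣ ℕ.> 1 → suc m ℕ.< n ⊎ suc n ℕ.< m
∣-∣>1⇒ zero    n       gt = inj₁ gt
∣-∣>1⇒ (suc m) zero    gt = inj₂ gt
∣-∣>1⇒ (suc m) (suc n) gt with ∣-∣>1⇒ m n gt
... | inj₁ p = inj₁ (ℕ.s≤s p)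
... | inj₂ p = inj₂ (ℕ.s≤s p)

∣n-1+n∣≡1 : ∀ n → ℕ.∣ n - suc n ∣ ≡ 1
∣n-1+n∣≡1 zero    = refl
∣n-1+n∣≡1 (suc n) = ∣n-1+n∣≡1 n

1+m<n⇒∣m-n∣>1 : ∀ {m n} → suc m ℕ.< n → ℕ.∣ m - n ∣ ℕ.> 1
1+m<n⇒∣m-n∣>1 {zero}  1<n             = 1<n
1+m<n⇒∣m-n∣>1 {suc m} (ℕ.s≤s 1+m<n) = 1+m<n⇒∣m-n∣>1 1+m<n

-- If `y` were missed, punching it out would inject `Fin (suc n)` into `Fin n`.
injective⇒surjective : ∀ {n} (f : Fin n → Fin n) → Injective _≡_ _≡_ f → ∀ y → ∃[ x ] f x ≡ y
injective⇒surjective {suc n} f f-injective y with Fin.any? (λ x → f x Fin.≟ y)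
... | yes x∈    = x∈
... | no  y∉f = contradiction
  (Fin.injective⇒≤ λ {i} {j} eq → f-injective (Fin.punchOut-injective (y≢f i) (y≢f j) eq)) ℕ.1+n≰n
  where
    y≢f : ∀ i → y ≢ f i
    y≢f i y≡fi = y∉f (i , ≡.sym y≡fi)

injective⇒permutation : ∀ {n} (f : Fin n → Fin n) → Injective _≡_ _≡_ f → Permutation′ n
injective⇒permutation f f-injective = permutation f f⁻¹ f-f⁻¹ (λ x → f-injective (f-f⁻¹ (f x)))
  where
    f⁻¹ : ∀ y → _
    f⁻¹ y = proj₁ (injective⇒surjective f f-injective y)
    f-f⁻¹ : ∀ y → f (f⁻¹ y) ≡ y
    f-f⁻¹ y = proj₂ (injective⇒surjective f f-injective y)

-- Products of adjacency matrices and nonzero intersection numbers.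

module Scheme {d n : ℕ} (𝒳 : AssociationScheme d n) where
  open AssociationScheme 𝒳

  -- `R?` compares `i` with the index that `covering` assigns to the pair, so an entry of `A k` is
  -- by computation a `δ` and the sum collapses.
  combination-A : ∀ c {j x y} → R j x y → combination c A x y ≈ c j
  combination-A c {j} {x} {y} r = begin
    sum (λ k → c k * δ (proj₁ (covering x y)) k)  ≈⟨ sum-*δ c _ ⟩
    c (proj₁ (covering x y))                      ≡⟨ cong c (disjoint (proj₂ (covering x y)) r) ⟩
    c j                                           ∎

  A-*ₘ-A : ∀ i j → A i *ₘ A j ≈ₘ combination (λ h → ι (p h i j)) A
  A-*ₘ-A i j x y = let h , r = covering x y in begin
    sum (λ z → A i x z * A j z y)
      ≈⟨ sum-cong-≋ (λ z → indicator-∧ (does (R? i x z)) (does (R? j z y))) ⟩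
    sum (λ z → indicator (does (R? i x z ×-dec R? j z y)))
      ≈⟨ sum-indicator (λ z → R? i x z ×-dec R? j z y) id ⟩
    ι (count (λ z → R? i x z ×-dec R? j z y) (tabulate id))
      ≡⟨ cong ι (p-intersection h i j x y r) ⟨
    ι (p h i j)
      ≈⟨ combination-A (λ h → ι (p h i j)) r ⟨
    combination (λ h → ι (p h i j)) A x y ∎

  -- A triangle witnesses `p h i j ≢ 0`. As the relations are symmetric, its corners can be
  -- permuted, which gives the symmetries of nonvanishing in `h`, `i`, `j`.
  Triangle : Fin (suc d) → Fin (suc d) → Fin (suc d) → Set
  Triangle h i j = ∃[ x ] ∃[ y ] ∃[ z ] R h x y × R i x z × R j z y

  p≢0⇒triangle : ∀ {h i j} → p h i j ≢ 0 → Triangle h i j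
  p≢0⇒triangle {h} {i} {j} ≢0 =
    let x , y , r = R-nonempty h
        z , s , t = count≢0⇒∃ (λ z → R? i x z ×-dec R? j z y) id
                      (≢0 ∘ ≡.trans (p-intersection h i j x y r))
    in x , y , z , r , s , t

  triangle⇒p≢0 : ∀ {h i j} → Triangle h i j → p h i j ≢ 0
  triangle⇒p≢0 {h} {i} {j} (x , y , z , r , s , t) =
    ∃⇒count≢0 (λ z → R? i x z ×-dec R? j z y) id z (s , t) ∘ ≡.trans (≡.sym (p-intersection h i j x y r))

  p≢0-rotate : ∀ {h i j} → p h i j ≢ 0 → p j h i ≢ 0
  p≢0-rotate ≢0 = let x , y , z , r , s , t = p≢0⇒triangle ≢0 in
    triangle⇒p≢0 (y , z , x , symmetric t , symmetric r , s)

  p≢0-swap : ∀ {h i j} → p h i j ≢ 0 → p h j i ≢ 0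
  p≢0-swap ≢0 = let x , y , z , r , s , t = p≢0⇒triangle ≢0 in
    triangle⇒p≢0 (y , x , z , symmetric r , symmetric t , symmetric s)

  -- An edge in the trivial relation identifies two corners, so `h` and `i` relate the same pair.
  p-trivial≢0 : ∀ {h i} → p h i zero ≢ 0 → h ≡ i
  p-trivial≢0 ≢0 with x , y , z , r , s , t ← p≢0⇒triangle ≢0
    with refl ← Equivalence.to (R₀-diagonal z y) t = disjoint r s

  ∣X∣*∣X∣⁻¹ : ∣X∣ * ∣X∣⁻¹ ≈ 1ℝ
  ∣X∣*∣X∣⁻¹ = ≡⇒≈ λ _ → ℚ.*-inverseʳ sizeℚ

  ∣X∣#0 : ∣X∣ # 0ℝ
  ∣X∣#0 = invertible⇒# ∣X∣⁻¹ (≈-trans (solve 2 (λ a b → b :* (a :- con ℚ.0ℚ) := a :* b) ≈-refl ∣X∣ ∣X∣⁻¹) ∣X∣*∣X∣⁻¹)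

  -- Relations between `P` and `Q`.

  module Eigenvalues (ℰ : PrimitiveIdempotents 𝒳) where
    open PrimitiveIdempotents ℰ

    E-coefficients-unique : ∀ c c′ → combination c E ≈ₘ combination c′ E → ∀ i → c i ≈ c′ i
    E-coefficients-unique c c′ eq i = begin
      c i                  ≈⟨ solve 2 (λ a b → a := a :- b :+ b) ≈-refl (c i) (c′ i) ⟩
      (c i - c′ i) + c′ i  ≈⟨ +-cong (independent (λ i → c i - c′ i) difference i) ≈-refl ⟩
      0ℝ + c′ i            ≈⟨ +-identityˡ (c′ i) ⟩
      c′ i                 ∎
      where
        difference : combination (λ i → c i - c′ i) E ≈ₘ zeroₘ
        difference x y = begin
          sum (λ i → (c i - c′ i) * E i x y)
            ≈⟨ sum-cong-≋ (λ i → solve 3 (λ a b e → (a :- b) :* e := a :* e :- b :* e) ≈-refl (c i) (c′ i) (E i x y)) ⟩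
          sum (λ i → c i * E i x y - c′ i * E i x y)
            ≈⟨ sum-difference (λ i → c i * E i x y) (λ i → c′ i * E i x y) ⟩
          combination c E x y - combination c′ E x y
            ≈⟨ +-congʳ (eq x y) ⟩
          combination c′ E x y - combination c′ E x y
            ≈⟨ -‿inverseʳ (combination c′ E x y) ⟩
          0ℝ ∎

    -- q = |X|⁻¹ Q, the coefficients of the E j in the basis A.
    q : Fin (suc d) → Fin (suc d) → ℝ
    q k j = proj₁ (members j) k

    -- `P` and `q` are the transition matrices between the bases `A` and `E`; here `E j` is expanded
    -- in `A` and then back in `E`.
    P-q : ∀ i j → sum (λ k → q k j * P i k) ≈ δ i j
    P-q i j = E-coefficients-unique (λ i → sum (λ k → q k j * P i k)) (λ i → δ i j) (λ x y → begin
      combination (λ i → sum (λ k → q k j * P i k)) E x y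
        ≈⟨ combination-combination (λ k → q k j) (λ k i → P i k) E x y ⟨
      combination (λ k → q k j) (λ k → combination (λ i → P i k) E) x y
        ≈⟨ combination-congʳ (λ k → q k j) P-expansion x y ⟨
      combination (λ k → q k j) A x y
        ≈⟨ proj₂ (members j) x y ⟨
      E j x y
        ≈⟨ proj₂ (member∈Span E j) x y ⟩
      combination (λ i → δ i j) E x y ∎) i

    P-trivial : ∀ i → P i zero ≈ 1ℝ
    P-trivial = E-coefficients-unique (λ i → P i zero) (λ _ → 1ℝ) λ x y → begin
      combination (λ i → P i zero) E x y  ≈⟨ P-expansion zero x y ⟨
      A zero x y                          ≡⟨ cong indicator (does-⇔ (R₀-diagonal x y) (R? zero x y) (x Fin.≟ y)) ⟩
      δ x y                               ≈⟨ complete x y ⟩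
      sum (λ i → E i x y)                 ≈⟨ sum-cong-≋ (λ i → *-identityˡ (E i x y)) ⟨
      combination (λ _ → 1ℝ) E x y        ∎

    -- Evaluates `E zero` at a pair in `R i`, once by its expansion in `A` and once as a multiple of
    -- the all-ones matrix.
    Q-trivial : ∀ i → Q i zero ≈ 1ℝ
    Q-trivial i = let x , y , r = R-nonempty i in begin
      ∣X∣ * q i zero                        ≈⟨ *-congˡ (combination-A (λ k → q k zero) r) ⟨
      ∣X∣ * combination (λ k → q k zero) A x y  ≈⟨ *-congˡ (proj₂ (members zero) x y) ⟨
      ∣X∣ * E zero x y                      ≈⟨ *-congˡ (E₀-trivial x y) ⟩
      ∣X∣ * (∣X∣⁻¹ * 1ℝ)                    ≈⟨ *-congˡ (*-identityʳ ∣X∣⁻¹) ⟩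
      ∣X∣ * ∣X∣⁻¹                           ≈⟨ ∣X∣*∣X∣⁻¹ ⟩
      1ℝ                                    ∎

    -- The inverse relation in the other order: `A h` is expanded in `E`, then in `A`, and the
    -- coefficient of `A c` is read off at a pair in `R c`.
    Q-P : ∀ c h → sum (λ k → Q c k * P k h) ≈ ∣X∣ * δ c h
    Q-P c h = let x , y , r = R-nonempty c in begin
      sum (λ k → ∣X∣ * q c k * P k h)
        ≈⟨ sum-cong-≋ (λ k → ≈-trans (*-assoc ∣X∣ (q c k) (P k h)) (*-congˡ (*-comm (q c k) (P k h)))) ⟩
      sum (λ k → ∣X∣ * (P k h * q c k))
        ≈⟨ *-distribˡ-sum ∣X∣ (λ k → P k h * q c k) ⟨
      ∣X∣ * sum (λ k → P k h * q c k)
        ≈⟨ *-congˡ (combination-A (λ j → sum (λ k → P k h * q j k)) r) ⟨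
      ∣X∣ * combination (λ j → sum (λ k → P k h * q j k)) A x y
        ≈⟨ *-congˡ (combination-combination (λ k → P k h) (λ k j → q j k) A x y) ⟨
      ∣X∣ * combination (λ k → P k h) (λ k → combination (λ j → q j k) A) x y
        ≈⟨ *-congˡ (combination-congʳ (λ k → P k h) (λ k → proj₂ (members k)) x y) ⟨
      ∣X∣ * combination (λ k → P k h) E x y
        ≈⟨ *-congˡ (P-expansion h x y) ⟨
      ∣X∣ * A h x y
        ≈⟨ *-congˡ (proj₂ (member∈Span A h) x y) ⟩
      ∣X∣ * combination (λ i → δ i h) A x y
        ≈⟨ *-congˡ (combination-A (λ i → δ i h) r) ⟩
      ∣X∣ * δ c h ∎

    A-*ₘ-E : ∀ j k → A j *ₘ E k ≈ₘ P k j ·ₘ E k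
    A-*ₘ-E j k x y = begin
      (A j *ₘ E k) x y
        ≈⟨ *ₘ-congʳ (E k) (P-expansion j) x y ⟩
      (combination (λ i → P i j) E *ₘ E k) x y
        ≈⟨ combination-*ₘ (λ i → P i j) E (E k) x y ⟩
      combination (λ i → P i j) (λ i → E i *ₘ E k) x y
        ≈⟨ combination-congʳ (λ i → P i j) (λ i → orthogonal i k) x y ⟩
      sum (λ i → P i j * (δ i k * E i x y))
        ≈⟨ sum-cong-≋ (λ i → x∙yz≈y∙xz (P i j) (δ i k) (E i x y)) ⟩
      sum (λ i → δ i k * (P i j * E i x y))
        ≈⟨ sum-δ (λ i → P i j * E i x y) k ⟩
      P k j * E k x y ∎

    -- Both sides are the coefficient of `E k` in `A i *ₘ A j`, found from the eigenvalues and from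
    -- the intersection numbers.
    P-*-P : ∀ k i j → P k i * P k j ≈ sum (λ h → ι (p h i j) * P k h)
    P-*-P k i j = E-coefficients-unique (λ k → P k i * P k j) (λ k → sum (λ h → ι (p h i j) * P k h)) (λ x y → begin
      combination (λ k → P k i * P k j) E x y
        ≈⟨ sum-cong-≋ (λ k → solve 3 (λ a b e → a :* b :* e := b :* (a :* e)) ≈-refl (P k i) (P k j) (E k x y)) ⟩
      combination (λ k → P k j) (λ k → P k i ·ₘ E k) x y
        ≈⟨ combination-congʳ (λ k → P k j) (A-*ₘ-E i) x y ⟨
      combination (λ k → P k j) (λ k → A i *ₘ E k) x y
        ≈⟨ *ₘ-combination (A i) (λ k → P k j) E x y ⟨
      (A i *ₘ combination (λ k → P k j) E) x y
        ≈⟨ *ₘ-congˡ (A i) (P-expansion j) x y ⟨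
      (A i *ₘ A j) x y
        ≈⟨ A-*ₘ-A i j x y ⟩
      combination (λ h → ι (p h i j)) A x y
        ≈⟨ combination-congʳ (λ h → ι (p h i j)) P-expansion x y ⟩
      combination (λ h → ι (p h i j)) (λ h → combination (λ k → P k h) E) x y
        ≈⟨ combination-combination (λ h → ι (p h i j)) (λ h k → P k h) E x y ⟩
      combination (λ k → sum (λ h → ι (p h i j) * P k h)) E x y ∎) k

  -- The criterion in terms of the matrices `P` and `Q`.

  -- P, Q and q are abstract here so that the eigenvalues, which are projections
  -- out of spanning proofs, never unfold during conversion checking.
  module PPolynomialCriterion
    (P Q q : Fin (suc d) → Fin (suc d) → ℝ)
    (P-trivial : ∀ i → P i zero ≈ 1ℝ)
    (Q-trivial : ∀ i → Q i zero ≈ 1ℝ)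
    (P-q : ∀ i j → sum (λ k → q k j * P i k) ≈ δ i j)
    (Q-P : ∀ i j → sum (λ k → Q i k * P k j) ≈ ∣X∣ * δ i j)
    (P-*-P : ∀ k i j → P k i * P k j ≈ sum (λ h → ι (p h i j) * P k h))
    (b c : Fin (suc d)) (b≢0 : b ≢ zero) where

    θ : Fin (suc d) → ℝ
    θ i = P i b

    -- A nontrivial `b` forces `d` to be at least 1. The helper generalises the bound to `m` because
    -- `d` is a module parameter.
    one : ∃[ i ] toℕ i ≡ 1
    one = from b b≢0
      where
        from : ∀ {m} (i : Fin (suc m)) → i ≢ zero → Σ[ j ∈ Fin (suc m) ] toℕ j ≡ 1
        from         zero    i≢0 = contradiction refl i≢0
        from {suc m} (suc i) _   = suc zero , refl

    -- For `g k = Q c k * f (θ k)` with `f` a polynomial, this is |X| times the coefficient of `A c`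
    -- in f(B) A_h, where B = `A b`.
    pairing : (Fin (suc d) → ℝ) → Fin (suc d) → ℝ
    pairing g h = sum λ k → g k * P k h

    pairing-cong : ∀ {f g} h → (∀ k → f k ≈ g k) → pairing f h ≈ pairing g h
    pairing-cong h f≈g = sum-cong-≋ λ k → *-congʳ {P k h} (f≈g k)

    -- A further factor `θ` multiplies A_h by B, and the product of B with A_h is the sum of the
    -- `p j b h` multiples of A_j.
    pairing-θ : ∀ g h → pairing (λ k → g k * θ k) h ≈ sum (λ j → ι (p j b h) * pairing g j)
    pairing-θ g h = begin
      sum (λ k → g k * θ k * P k h)
        ≈⟨ sum-cong-≋ (λ k → ≈-trans (*-assoc (g k) (θ k) (P k h)) (≈-trans (*-congˡ (P-*-P k b h))
             (*-distribˡ-sum (g k) (λ j → ι (p j b h) * P k j)))) ⟩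
      sum (λ k → sum (λ j → g k * (ι (p j b h) * P k j)))
        ≈⟨ ∑-comm (λ k j → g k * (ι (p j b h) * P k j)) ⟩
      sum (λ j → sum (λ k → g k * (ι (p j b h) * P k j)))
        ≈⟨ sum-cong-≋ (λ j → ≈-trans (sum-cong-≋ λ k → x∙yz≈y∙xz (g k) (ι (p j b h)) (P k j))
             (≈-sym (*-distribˡ-sum (ι (p j b h)) (λ k → g k * P k j)))) ⟩
      sum (λ j → ι (p j b h) * pairing g j) ∎

    -- From a P-polynomial structure to the dual eigenvalues.

    module FromPPolynomial
      (structure : PPolynomialRelativeTo b)
      (last≡c : PPolynomialRelativeTo.last structure ≡ c) where
      open PPolynomialRelativeTo structure
      open IsPPolynomialOrdering isPPolynomial

      σ σ⁻¹ : Fin (suc d) → Fin (suc d)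
      σ k   = ordering ⟨$⟩ʳ k
      σ⁻¹ k = ordering ⟨$⟩ˡ k

      σ-one : σ (proj₁ one) ≡ b
      σ-one = first (proj₁ one) (proj₂ one)

      -- Two rotations bring `b`, which is `σ` of index 1, into the upper position that the
      -- definition of the ordering speaks about.
      p-vanishing : ∀ {k l} → suc (toℕ l) ℕ.< toℕ k → p (σ k) b (σ l) ≡ 0
      p-vanishing {k} {l} gap = decidable-stable (p (σ k) b (σ l) ℕ.≟ 0) λ ≢0 →
        p≢0-rotate (p≢0-rotate ≢0)
          (subst (λ a → p a (σ l) (σ k) ≡ 0) σ-one (vanishing (proj₁ one) l k (proj₂ one) (1+m<n⇒∣m-n∣>1 gap)))

      p-nonvanishing : ∀ {k l} → toℕ k ≡ suc (toℕ l) → p (σ k) b (σ l) ≢ 0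
      p-nonvanishing {k} {l} k≡1+l = p≢0-rotate
        (subst (λ a → p a (σ l) (σ k) ≢ 0) σ-one (nonvanishing (proj₁ one) l k (proj₂ one)
          (≡.trans (cong (λ t → ℕ.∣ toℕ l - t ∣) k≡1+l) (∣n-1+n∣≡1 (toℕ l)))))

      next : ∀ {m} (l : Fin (suc d)) → suc m ℕ.+ toℕ l ℕ.≤ d → ∃[ k ] toℕ k ≡ suc (toℕ l)
      next {m} l le = fromℕ< 1+l<1+d , Fin.toℕ-fromℕ< 1+l<1+d
        where
          1+l<1+d : suc (toℕ l) ℕ.< suc d
          1+l<1+d = ℕ.s≤s (ℕ.≤-trans (ℕ.s≤s (ℕ.m≤n+m (toℕ l) m)) le)

      module _ (i j : Fin (suc d)) where
        Δ : Fin (suc d) → ℝ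
        Δ h = P i h - P j h

        -- This is the difference of the identities `P-*-P` for `i` and `j`. The left side is
        -- grouped so that `θ i - θ j` divides it as soon as it divides `Δ h`.
        Δ-recurrence : ∀ h → θ i * Δ h + P j h * (θ i - θ j) ≈ sum (λ l → ι (p l b h) * Δ l)
        Δ-recurrence h = begin
          θ i * Δ h + P j h * (θ i - θ j)
            ≈⟨ solve 4 (λ a b u v → a :* (u :- v) :+ v :* (a :- b) := a :* u :- b :* v)
                 ≈-refl (θ i) (θ j) (P i h) (P j h) ⟩
          θ i * P i h - θ j * P j h
            ≈⟨ +-cong (P-*-P i b h) (-‿cong (P-*-P j b h)) ⟩
          sum (λ l → ι (p l b h) * P i l) - sum (λ l → ι (p l b h) * P j l)
            ≈⟨ sum-difference (λ l → ι (p l b h) * P i l) (λ l → ι (p l b h) * P j l) ⟨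
          sum (λ l → ι (p l b h) * P i l - ι (p l b h) * P j l)
            ≈⟨ sum-cong-≋ (λ l → solve 3 (λ n u v → n :* u :- n :* v := n :* (u :- v))
                 ≈-refl (ι (p l b h)) (P i l) (P j l)) ⟩
          sum (λ l → ι (p l b h) * Δ l) ∎

        -- In the recurrence at the predecessor `l` of `k`, terms before `k` are divisible by
        -- induction and terms after `k` vanish. So the term of `σ k` is divisible, and its
        -- coefficient is a nonzero natural number. The bound `m` makes the recursion structural.
        θ-difference∣Δ : ∀ m k → toℕ k ℕ.≤ m → θ i - θ j ∣ Δ (σ k)
        θ-difference∣Δ m zero _ = subst (λ h → θ i - θ j ∣ Δ h) (≡.sym fixes-trivial)
          (≈0⇒∣ (≈-trans (+-cong (P-trivial i) (-‿cong (P-trivial j))) (-‿inverseʳ 1ℝ)))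
        θ-difference∣Δ (suc m) k@(suc k′) (ℕ.s≤s k′≤m) =
          ∣-cancel-#0 (ι-#0 (p-nonvanishing {k} {l} (cong suc (≡.sym l≡k′))))
            (∣-sum⇒∣-term (λ h → ι (p h b (σ l)) * Δ h) (σ k)
              (∣-respʳ (Δ-recurrence (σ l))
                (∣-+ (x∣ʳy⇒x∣ʳzy (θ i) (θ-difference∣Δ m l l≤m)) (P j (σ l) , ≈-refl)))
              other)
          where
            l : Fin (suc d)
            l = inject₁ k′
            l≡k′ : toℕ l ≡ toℕ k′
            l≡k′ = Fin.toℕ-inject₁ k′
            l≤m : toℕ l ℕ.≤ m
            l≤m = subst (ℕ._≤ m) (≡.sym l≡k′) k′≤m
            at-σ : ∀ g → g ≢ k → θ i - θ j ∣ ι (p (σ g) b (σ l)) * Δ (σ g)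
            at-σ g g≢k with ℕ.<-cmp (toℕ g) (toℕ k)
            ... | tri< g<k _ _ = x∣ʳy⇒x∣ʳzy _ (θ-difference∣Δ m g (ℕ.≤-trans (ℕ.s≤s⁻¹ g<k) k′≤m))
            ... | tri≈ _ g≡k _ = contradiction (Fin.toℕ-injective g≡k) g≢k
            ... | tri> _ _ k<g = ≈0⇒∣ (ι≡0-*
                    (p-vanishing {g} {l} (subst (λ a → suc a ℕ.< toℕ g) (≡.sym l≡k′) k<g)) (Δ (σ g)))
            other : ∀ h → h ≢ σ k → θ i - θ j ∣ ι (p h b (σ l)) * Δ h
            other h h≢σk = subst (λ h → θ i - θ j ∣ ι (p h b (σ l)) * Δ h) (inverseʳ ordering)
              (at-σ (σ⁻¹ h) λ eq → h≢σk (≡.trans (≡.sym (inverseʳ ordering)) (cong σ eq)))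

        θ-difference∣Δ-all : ∀ h → θ i - θ j ∣ Δ h
        θ-difference∣Δ-all h = subst (λ h → θ i - θ j ∣ Δ h) (inverseʳ ordering) (θ-difference∣Δ _ (σ⁻¹ h) ℕ.≤-refl)

      -- By `P-q` the differences `Δ i j k`, weighted with `q k i`, add up to `δ i i - δ j i`, which
      -- is 1.
      θ-difference∣1 : ∀ {i j} → i ≢ j → θ i - θ j ∣ 1ℝ
      θ-difference∣1 {i} {j} i≢j = ∣-respʳ (begin
        sum (λ k → q k i * Δ i j k)
          ≈⟨ sum-cong-≋ (λ k → solve 3 (λ q u v → q :* (u :- v) := q :* u :- q :* v)
               ≈-refl (q k i) (P i k) (P j k)) ⟩
        sum (λ k → q k i * P i k - q k i * P j k)
          ≈⟨ sum-difference (λ k → q k i * P i k) (λ k → q k i * P j k) ⟩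
        sum (λ k → q k i * P i k) - sum (λ k → q k i * P j k)
          ≈⟨ +-cong (P-q i i) (-‿cong (P-q j i)) ⟩
        δ i i - δ j i
          ≡⟨ ≡.cong₂ _-_ (δ-refl i) (δ-≢ (i≢j ∘ ≡.sym)) ⟩
        1ℝ - 0ℝ
          ≈⟨ ≡⇒≈ (λ _ → refl) ⟩
        1ℝ ∎)
        (∣-sum (λ k → q k i * Δ i j k) λ k → x∣ʳy⇒x∣ʳzy (q k i) (θ-difference∣Δ-all i j k))

      distinct : MutuallyDistinct θ
      distinct i j i≢j = -∣1⇒# (θ-difference∣1 i≢j)

      -- Up to |X|, the coefficient of A c in Π_j (B - t j) A_h.
      pairingΠ : ∀ m → (Fin m → ℝ) → Fin (suc d) → ℝ
      pairingΠ m t = pairing λ k → Q c k * product λ j → θ k - t j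

      pairingΠ-recurrence : ∀ m (t : Fin (suc m) → ℝ) h →
        pairingΠ (suc m) t h ≈ sum (λ j → ι (p j b h) * pairingΠ m (t ∘ suc) j) + - t zero * pairingΠ m (t ∘ suc) h
      pairingΠ-recurrence m t h = begin
        sum (λ k → Q c k * ((θ k - t zero) * Π k) * P k h)
          ≈⟨ sum-cong-≋ (λ k → solve 5 (λ q x t y z →
               q :* ((x :- t) :* y) :* z := q :* y :* x :* z :+ (:- t) :* (q :* y :* z))
               ≈-refl (Q c k) (θ k) (t zero) (Π k) (P k h)) ⟩
        sum (λ k → Q c k * Π k * θ k * P k h + - t zero * (Q c k * Π k * P k h))
          ≈⟨ ∑-distrib-+ (λ k → Q c k * Π k * θ k * P k h) (λ k → - t zero * (Q c k * Π k * P k h)) ⟩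
        pairing (λ k → Q c k * Π k * θ k) h + sum (λ k → - t zero * (Q c k * Π k * P k h))
          ≈⟨ +-cong (pairing-θ (λ k → Q c k * Π k) h) (≈-sym (*-distribˡ-sum (- t zero) (λ k → Q c k * Π k * P k h))) ⟩
        sum (λ j → ι (p j b h) * pairingΠ m (t ∘ suc) j) + - t zero * pairingΠ m (t ∘ suc) h ∎
        where
          Π : Fin (suc d) → ℝ
          Π k = product λ j → θ k - t (suc j)

      -- Each factor advances at most one place along the ordering, so `m` factors starting at `σ l`
      -- stop short of `c`, which is `σ` of index `d`.
      pairingΠ-vanishing : ∀ m t l → m ℕ.+ toℕ l ℕ.< d → pairingΠ m t (σ l) ≈ 0ℝ
      pairingΠ-vanishing zero t l l<d = begin
        sum (λ k → Q c k * 1ℝ * P k (σ l))  ≈⟨ pairing-cong (σ l) (λ k → *-identityʳ (Q c k)) ⟩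
        sum (λ k → Q c k * P k (σ l))       ≈⟨ Q-P c (σ l) ⟩
        ∣X∣ * δ c (σ l)                     ≡⟨ cong (∣X∣ *_) (δ-≢ c≢σl) ⟩
        ∣X∣ * 0ℝ                            ≈⟨ zeroʳ ∣X∣ ⟩
        0ℝ                                  ∎
        where
          c≢σl : c ≢ σ l
          c≢σl c≡σl = ℕ.<⇒≢ l<d (≡.trans (cong toℕ l≡d) (Fin.toℕ-fromℕ d))
            where
              l≡d : l ≡ fromℕ d
              l≡d = ≡.trans (≡.sym (inverseˡ ordering))
                (≡.trans (cong σ⁻¹ (≡.sym (≡.trans last≡c c≡σl))) (inverseˡ ordering))
      pairingΠ-vanishing (suc m) t l m+l<d = begin
        pairingΠ (suc m) t (σ l)
          ≈⟨ pairingΠ-recurrence m t (σ l) ⟩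
        sum (λ j → ι (p j b (σ l)) * pairingΠ m (t ∘ suc) j) + - t zero * pairingΠ m (t ∘ suc) (σ l)
          ≈⟨ +-cong (sum-zero _ term) (≈-trans (*-congˡ (pairingΠ-vanishing m (t ∘ suc) l (ℕ.<-trans (ℕ.n<1+n _) m+l<d))) (zeroʳ _)) ⟩
        0ℝ + 0ℝ
          ≈⟨ +-identityˡ 0ℝ ⟩
        0ℝ ∎
        where
          at-σ : ∀ g → ι (p (σ g) b (σ l)) * pairingΠ m (t ∘ suc) (σ g) ≈ 0ℝ
          at-σ g with toℕ g ℕ.≤? suc (toℕ l)
          ... | yes g≤1+l = ≈-trans (*-congˡ (pairingΠ-vanishing m (t ∘ suc) g (ℕ.≤-<-trans
                  (ℕ.≤-trans (ℕ.+-monoʳ-≤ m g≤1+l) (ℕ.≤-reflexive (ℕ.+-suc m (toℕ l)))) m+l<d))) (zeroʳ _)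
          ... | no  g≰1+l = ι≡0-* (p-vanishing {g} {l} (ℕ.≰⇒> g≰1+l)) _
          term : ∀ h → ι (p h b (σ l)) * pairingΠ m (t ∘ suc) h ≈ 0ℝ
          term h = subst (λ h → ι (p h b (σ l)) * pairingΠ m (t ∘ suc) h ≈ 0ℝ) (inverseʳ ordering) (at-σ (σ⁻¹ h))

      -- With exactly enough factors left to reach `c`, each factor has to advance. All other terms
      -- fall to the two vanishing lemmas, among them the only one that contains `t zero`.
      pairingΠ-leading : ∀ m t l → suc m ℕ.+ toℕ l ≡ d → ∀ k → toℕ k ≡ suc (toℕ l) →
                  pairingΠ (suc m) t (σ l) ≈ ι (p (σ k) b (σ l)) * pairingΠ m (t ∘ suc) (σ k)
      pairingΠ-leading m t l 1+m+l≡d k k≡1+l = begin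
        pairingΠ (suc m) t (σ l)
          ≈⟨ pairingΠ-recurrence m t (σ l) ⟩
        sum (λ j → ι (p j b (σ l)) * pairingΠ m (t ∘ suc) j) + - t zero * pairingΠ m (t ∘ suc) (σ l)
          ≈⟨ +-cong (sum-single _ (σ k) other) (≈-trans (*-congˡ (pairingΠ-vanishing m (t ∘ suc) l (ℕ.≤-reflexive 1+m+l≡d))) (zeroʳ _)) ⟩
        ι (p (σ k) b (σ l)) * pairingΠ m (t ∘ suc) (σ k) + 0ℝ
          ≈⟨ +-identityʳ _ ⟩
        ι (p (σ k) b (σ l)) * pairingΠ m (t ∘ suc) (σ k) ∎
        where
          at-σ : ∀ g → g ≢ k → ι (p (σ g) b (σ l)) * pairingΠ m (t ∘ suc) (σ g) ≈ 0ℝ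
          at-σ g g≢k with ℕ.<-cmp (toℕ g) (suc (toℕ l))
          ... | tri< g<1+l _ _ = ≈-trans (*-congˡ (pairingΠ-vanishing m (t ∘ suc) g (ℕ.≤-<-trans
                  (ℕ.+-monoʳ-≤ m (ℕ.s≤s⁻¹ g<1+l)) (ℕ.≤-reflexive 1+m+l≡d)))) (zeroʳ _)
          ... | tri≈ _ g≡1+l _ = contradiction (Fin.toℕ-injective (≡.trans g≡1+l (≡.sym k≡1+l))) g≢k
          ... | tri> _ _ 1+l<g = ι≡0-* (p-vanishing {g} {l} 1+l<g) _
          other : ∀ h → h ≢ σ k → ι (p h b (σ l)) * pairingΠ m (t ∘ suc) h ≈ 0ℝ
          other h h≢σk = subst (λ h → ι (p h b (σ l)) * pairingΠ m (t ∘ suc) h ≈ 0ℝ) (inverseʳ ordering)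
            (at-σ (σ⁻¹ h) λ eq → h≢σk (≡.trans (≡.sym (inverseʳ ordering)) (cong σ eq)))

      -- Monic polynomials of equal degree have the same top coefficient: `pairingΠ-leading`
      -- discards the roots one at a time until the product is empty.
      pairingΠ-independent : ∀ m t t′ l → m ℕ.+ toℕ l ≡ d → pairingΠ m t (σ l) ≈ pairingΠ m t′ (σ l)
      pairingΠ-independent zero    t t′ l _  = ≈-refl
      pairingΠ-independent (suc m) t t′ l eq = let k , k≡1+l = next {m} l (ℕ.≤-reflexive eq) in begin
        pairingΠ (suc m) t (σ l)
          ≈⟨ pairingΠ-leading m t l eq k k≡1+l ⟩
        ι (p (σ k) b (σ l)) * pairingΠ m (t ∘ suc) (σ k)
          ≈⟨ *-congˡ (pairingΠ-independent m (t ∘ suc) (t′ ∘ suc) k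
               (≡.trans (cong (m ℕ.+_) k≡1+l) (≡.trans (ℕ.+-suc m (toℕ l)) eq))) ⟩
        ι (p (σ k) b (σ l)) * pairingΠ m (t′ ∘ suc) (σ k)
          ≈⟨ pairingΠ-leading m t′ l eq k k≡1+l ⟨
        pairingΠ (suc m) t′ (σ l) ∎

      -- With every `θ j` for `j ≢ i` as a root, only the summand of `i` survives. There the column
      -- of `P` at the trivial relation contributes 1.
      pairingΠ-denominator : ∀ i → pairingΠ d (θ ∘ punchIn i) (σ zero) ≈ Q c i * denominator θ i
      pairingΠ-denominator i = begin
        sum (λ k → Q c k * Π k * P k (σ zero))  ≈⟨ sum-single _ i vanish ⟩
        Q c i * Π i * P i (σ zero)              ≡⟨ cong (λ h → Q c i * Π i * P i h) fixes-trivial ⟩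
        Q c i * Π i * P i zero                  ≈⟨ *-congˡ (P-trivial i) ⟩
        Q c i * Π i * 1ℝ                        ≈⟨ *-identityʳ _ ⟩
        Q c i * denominator θ i                 ∎
        where
          Π : Fin (suc d) → ℝ
          Π k = product λ j → θ k - θ (punchIn i j)
          vanish : ∀ k → k ≢ i → Q c k * Π k * P k (σ zero) ≈ 0ℝ
          vanish k k≢i = begin
            Q c k * Π k * P k (σ zero)  ≈⟨ *-congʳ (*-congˡ (product-zero _ (punchOut (k≢i ∘ ≡.sym)) zero-factor)) ⟩
            Q c k * 0ℝ * P k (σ zero)   ≈⟨ solve 2 (λ q z → q :* con ℚ.0ℚ :* z := con ℚ.0ℚ) ≈-refl (Q c k) (P k (σ zero)) ⟩
            0ℝ                          ∎
            where
              zero-factor : θ k - θ (punchIn i (punchOut (k≢i ∘ ≡.sym))) ≈ 0ℝ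
              zero-factor = ≈-trans (+-congˡ (≡⇒≈ λ m →
                cong (λ a → seq (- θ a) m) (Fin.punchIn-punchOut (k≢i ∘ ≡.sym)))) (-‿inverseʳ (θ k))

      Q-denominator : ∀ i → Q c i * denominator θ i ≈ numerator θ
      Q-denominator i = begin
        Q c i * denominator θ i         ≈⟨ pairingΠ-denominator i ⟨
        pairingΠ d (θ ∘ punchIn i) (σ zero)    ≈⟨ pairingΠ-independent d _ _ zero (ℕ.+-identityʳ d) ⟩
        pairingΠ d (θ ∘ punchIn zero) (σ zero) ≈⟨ pairingΠ-denominator zero ⟩
        -- `denominator θ zero` is `numerator θ` by computation, since `punchIn zero` is `suc`.
        Q c zero * numerator θ          ≈⟨ *-congʳ (Q-trivial c) ⟩
        1ℝ * numerator θ                ≈⟨ *-identityˡ (numerator θ) ⟩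
        numerator θ                     ∎

      Q-formula : ∀ i → Q c i ≈ numerator θ ÷ denominator θ i [ denominator-#0 θ distinct i ]
      Q-formula i = begin
        Q c i               ≈⟨ *-identityʳ (Q c i) ⟨
        Q c i * 1ℝ          ≈⟨ *-congˡ (*-inverse D D#0) ⟨
        Q c i * (D * D⁻¹)   ≈⟨ *-assoc (Q c i) D D⁻¹ ⟨
        Q c i * D * D⁻¹     ≈⟨ *-congʳ (Q-denominator i) ⟩
        numerator θ * D⁻¹   ∎
        where
          D D⁻¹ : ℝ
          D = denominator θ i
          D#0 : D # 0ℝ
          D#0 = denominator-#0 θ distinct i
          D⁻¹ = inverse D D#0

    -- Power moments of the eigenvalues as walk counts.

    -- The number of walks of length m from h to c in the graph on the relations
    -- whose arrows h → j have weight p j b h.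
    walks : ℕ → Fin (suc d) → ℕ
    walks zero    h = if does (c Fin.≟ h) then 1 else 0
    walks (suc m) h = ℕΣ.sum λ j → p j b h ℕ.* walks m j

    -- Both sides are |X| times the coefficient of `A c` in the product of the `m`-th power of B
    -- with A_h; `pairing-θ` is the recursion that defines `walks`.
    pairing-walks : ∀ m h → pairing (λ k → Q c k * θ k ^ m) h ≈ ∣X∣ * ι (walks m h)
    pairing-walks zero h = begin
      sum (λ k → Q c k * 1ℝ * P k h)  ≈⟨ pairing-cong h (λ k → *-identityʳ (Q c k)) ⟩
      sum (λ k → Q c k * P k h)       ≈⟨ Q-P c h ⟩
      ∣X∣ * δ c h                     ≈⟨ *-congˡ (≈-sym (ι-if (does (c Fin.≟ h)))) ⟩
      ∣X∣ * ι (walks zero h)          ∎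
      where
        ι-if : ∀ t → ι (if t then 1 else 0) ≈ indicator t
        ι-if true  = +-identityʳ 1ℝ
        ι-if false = ≈-refl
    pairing-walks (suc m) h = begin
      pairing (λ k → Q c k * (θ k * θ k ^ m)) h
        ≈⟨ pairing-cong h (λ k → x∙yz≈xz∙y (Q c k) (θ k) (θ k ^ m)) ⟩
      pairing (λ k → Q c k * θ k ^ m * θ k) h
        ≈⟨ pairing-θ (λ k → Q c k * θ k ^ m) h ⟩
      sum (λ j → ι (p j b h) * pairing (λ k → Q c k * θ k ^ m) j)
        ≈⟨ sum-cong-≋ (λ j → ≈-trans (*-congˡ (pairing-walks m j)) (x∙yz≈y∙xz (ι (p j b h)) ∣X∣ (ι (walks m j)))) ⟩
      sum (λ j → ∣X∣ * (ι (p j b h) * ι (walks m j)))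
        ≈⟨ *-distribˡ-sum ∣X∣ (λ j → ι (p j b h) * ι (walks m j)) ⟨
      ∣X∣ * sum (λ j → ι (p j b h) * ι (walks m j))
        ≈⟨ *-congˡ (sum-cong-≋ λ j → ×1-homo-* (p j b h) (walks m j)) ⟨
      ∣X∣ * sum (λ j → ι (p j b h ℕ.* walks m j))
        ≈⟨ *-congˡ (ι-sum (λ j → p j b h ℕ.* walks m j)) ⟨
      ∣X∣ * ι (walks (suc m) h) ∎

    moment-walks : ∀ m → sum (λ k → Q c k * θ k ^ m) ≈ ∣X∣ * ι (walks m zero)
    moment-walks m = begin
      sum (λ k → Q c k * θ k ^ m)              ≈⟨ sum-cong-≋ (λ k → ≈-trans (*-congˡ {Q c k * θ k ^ m} (P-trivial k)) (*-identityʳ _)) ⟨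
      pairing (λ k → Q c k * θ k ^ m) zero     ≈⟨ pairing-walks m zero ⟩
      ∣X∣ * ι (walks m zero)                   ∎

    -- A walk ending at `c`, listed from its start `h`. Existence of a walk is equivalent to a
    -- nonzero count, and its vertices will form the ordering.
    data Walk : ℕ → Fin (suc d) → Set where
      done : Walk 0 c
      step : ∀ {m j h} → p j b h ≢ 0 → Walk m j → Walk (suc m) h

    walks≢0⇒Walk : ∀ m h → walks m h ≢ 0 → Walk m h
    walks≢0⇒Walk zero h ≢0 with c Fin.≟ h
    ... | yes refl = done
    ... | no  _    = contradiction refl ≢0
    walks≢0⇒Walk (suc m) h ≢0 = let j , pw≢0 = sum≢0⇒∃ (λ j → p j b h ℕ.* walks m j) ≢0 in
      step {j = j} (λ p≡0 → pw≢0 (cong (ℕ._* walks m j) p≡0))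
        (walks≢0⇒Walk m j λ w≡0 → pw≢0 (≡.trans (cong (p j b h ℕ.*_) w≡0) (ℕ.*-zeroʳ (p j b h))))

    Walk⇒walks≢0 : ∀ {m h} → Walk m h → walks m h ≢ 0
    Walk⇒walks≢0 done ≡0 with c Fin.≟ c
    ... | no c≢c = c≢c refl
    Walk⇒walks≢0 (step {m} {j} {h} p≢0 w) = ∃⇒sum≢0 (λ j → p j b h ℕ.* walks m j) j λ pw≡0 →
      [ p≢0 , Walk⇒walks≢0 w ]′ (ℕ.m*n≡0⇒m≡0∨n≡0 (p j b h) pw≡0)

    vertex : ∀ {m h} → Walk m h → Fin (suc m) → Fin (suc d)
    vertex {h = h} w        zero    = h
    vertex         (step _ w) (suc k) = vertex w k

    vertex-last : ∀ {m h} (w : Walk m h) → vertex w (fromℕ m) ≡ c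
    vertex-last done       = refl
    vertex-last (step _ w) = vertex-last w

    walk-from-vertex : ∀ {m h} (w : Walk m h) k → Walk (m ℕ.∸ toℕ k) (vertex w k)
    walk-from-vertex w          zero    = w
    walk-from-vertex (step _ w) (suc k) = walk-from-vertex w k

    -- Keeps the first `k` edges and replaces the rest, so that a shorter continuation produces a
    -- shorter walk.
    walk-via-vertex : ∀ {m l h} (w : Walk m h) k → Walk l (vertex w k) → Walk (toℕ k ℕ.+ l) h
    walk-via-vertex w          zero    v = v
    walk-via-vertex (step e w) (suc k) v = step e (walk-via-vertex w k v)

    walk-edge : ∀ {m h} (w : Walk m h) k l → suc (toℕ k) ≡ toℕ l → p (vertex w l) b (vertex w k) ≢ 0
    walk-edge (step e w) zero    (suc zero) _  = e
    walk-edge (step e w) (suc k) (suc l)    eq = walk-edge w k l (ℕ.suc-injective eq)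

    -- From a geodesic to a P-polynomial ordering.

    module FromGeodesic (w : Walk d zero) (shortest : ∀ {m} → m ℕ.< d → ¬ Walk m zero) where

      σ : Fin (suc d) → Fin (suc d)
      σ = vertex w

      -- Going to `σ i` along `w` and then along the given walk takes fewer than `d` edges. Here `a`
      -- is the cost of passing from `σ i` to `σ j`: 0 for a repeated vertex, 1 for a chord.
      shortcut : ∀ {a} (i j : Fin (suc d)) → a ℕ.+ toℕ i ℕ.< toℕ j → ¬ Walk (a ℕ.+ (d ℕ.∸ toℕ j)) (σ i)
      shortcut {a} i j a+i<j v = shortest lt (walk-via-vertex w i v)
        where
          j≤d : toℕ j ℕ.≤ d
          j≤d = Fin.toℕ≤pred[n] j
          lt : toℕ i ℕ.+ (a ℕ.+ (d ℕ.∸ toℕ j)) ℕ.< d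
          lt = ℕ.<-≤-trans (ℕ.≤-<-trans
                 (ℕ.≤-reflexive (≡.trans (≡.sym (ℕ.+-assoc (toℕ i) a _)) (cong (ℕ._+ (d ℕ.∸ toℕ j)) (ℕ.+-comm (toℕ i) a))))
                 (ℕ.+-monoˡ-< (d ℕ.∸ toℕ j) a+i<j))
               (ℕ.≤-reflexive (ℕ.m+[n∸m]≡n j≤d))

      no-chord : ∀ i j → suc (toℕ i) ℕ.< toℕ j → ¬ p (σ j) b (σ i) ≢ 0
      no-chord i j gap e = shortcut {1} i j gap (step e (walk-from-vertex w j))

      σ-injective : Injective _≡_ _≡_ σ
      σ-injective {i} {j} eq with ℕ.<-cmp (toℕ i) (toℕ j)
      ... | tri≈ _ i≡j _ = Fin.toℕ-injective i≡j
      ... | tri< i<j _ _ = contradiction (subst (Walk _) (≡.sym eq) (walk-from-vertex w j)) (shortcut {0} i j i<j)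
      ... | tri> _ _ j<i = contradiction (subst (Walk _) eq (walk-from-vertex w i)) (shortcut {0} j i j<i)

      -- The walk starts at the trivial relation, from which the only edge leads to `b`.
      σ-first : ∀ k → toℕ k ≡ 1 → σ k ≡ b
      σ-first k k≡1 = p-trivial≢0 (walk-edge w zero k (≡.sym k≡1))

      structure : PPolynomialRelativeTo b
      structure = record
        { ordering      = injective⇒permutation σ σ-injective
        ; isPPolynomial = record
          { fixes-trivial = refl
          -- The ordering has `b` as upper index, walk edges have it in the middle; rotations and
          -- swaps translate between the two.
          ; vanishing     = λ k i j k≡1 gap → subst (λ a → p a (σ i) (σ j) ≡ 0) (≡.sym (σ-first k k≡1))
              (decidable-stable (p b (σ i) (σ j) ℕ.≟ 0) λ ≢0 →
                [ (λ i<j → no-chord i j i<j (p≢0-rotate ≢0))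
                , (λ j<i → no-chord j i j<i (p≢0-rotate (p≢0-swap ≢0)))
                ]′ (∣-∣>1⇒ (toℕ i) (toℕ j) gap))
          ; nonvanishing  = λ k i j k≡1 adjacent → subst (λ a → p a (σ i) (σ j) ≢ 0) (≡.sym (σ-first k k≡1))
              ([ (λ 1+i≡j → p≢0-rotate (p≢0-rotate (walk-edge w i j 1+i≡j)))
               , (λ 1+j≡i → p≢0-swap (p≢0-rotate (p≢0-rotate (walk-edge w j i 1+j≡i))))
               ]′ (∣-∣≡1⇒ (toℕ i) (toℕ j) adjacent))
          }
        ; first = σ-first
        }

    -- From the dual eigenvalue formula to a geodesic.

    module FromFormula (distinct : MutuallyDistinct θ)
      (formula : ∀ i → Q c i ≈ numerator θ ÷ denominator θ i [ denominator-#0 θ distinct i ]) where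

      Q-denominator : ∀ i → Q c i * denominator θ i ≈ numerator θ
      Q-denominator i = begin
        Q c i * D                  ≈⟨ *-congʳ (formula i) ⟩
        numerator θ * D⁻¹ * D      ≈⟨ *-assoc (numerator θ) D⁻¹ D ⟩
        numerator θ * (D⁻¹ * D)    ≈⟨ *-congˡ (≈-trans (*-comm D⁻¹ D) (*-inverse D D#0)) ⟩
        numerator θ * 1ℝ           ≈⟨ *-identityʳ (numerator θ) ⟩
        numerator θ                ∎
        where
          D D⁻¹ : ℝ
          D = denominator θ i
          D#0 : D # 0ℝ
          D#0 = denominator-#0 θ distinct i
          D⁻¹ = inverse D D#0

      -- The formula makes `Q c` the divided-difference weights at the nodes `θ`, scaled by the
      -- numerator.
      moments : (∀ m → m ℕ.< d → sum (λ k → Q c k * θ k ^ m) ≈ 0ℝ) × sum (λ k → Q c k * θ k ^ d) ≈ numerator θ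
      moments = divided-difference d θ (Q c) (numerator θ) distinct Q-denominator

      -- A walk makes the count a nonzero natural number, hence the moment apart from 0, whereas
      -- moments of degree below `d` vanish.
      shortest : ∀ {m} → m ℕ.< d → ¬ Walk m zero
      shortest {m} m<d w = #-irrefl
        (≈-trans (≈-sym (moment-walks m)) (proj₁ moments m m<d))
        (*-#0 ∣X∣#0 (ι-#0 (Walk⇒walks≢0 w)))

      walk : Walk d zero
      walk = walks≢0⇒Walk d zero λ ≡0 → #-irrefl
        (begin
          numerator θ                  ≈⟨ proj₂ moments ⟨
          sum (λ k → Q c k * θ k ^ d)  ≈⟨ moment-walks d ⟩
          ∣X∣ * ι (walks d zero)       ≡⟨ cong (λ a → ∣X∣ * ι a) ≡0 ⟩
          ∣X∣ * 0ℝ                     ≈⟨ zeroʳ ∣X∣ ⟩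
          0ℝ                           ∎)
        -- The numerator is by computation the denominator at index 0, hence apart from 0.
        (denominator-#0 θ distinct zero)

theorem1p2 : {d n : ℕ} (𝒳 : AssociationScheme d n) (ℰ : PrimitiveIdempotents 𝒳) →
    let open AssociationScheme 𝒳
        open PrimitiveIdempotents ℰ
    in (b c : Fin (suc d)) → b ≢ zero →
    let θ : Fin (suc d) → ℝ
        θ i = P i b
    in (Σ[ structure ∈ PPolynomialRelativeTo b ] PPolynomialRelativeTo.last structure ≡ c)
       ⇔
       (Σ[ distinct ∈ MutuallyDistinct θ ]
          (∀ i → Q c i ≈ numerator θ ÷ denominator θ i [ denominator-#0 θ distinct i ]))
theorem1p2 𝒳 ℰ b c b≢0 = mk⇔
  (λ { (structure , last≡c) → let open FromPPolynomial structure last≡c in distinct , Q-formula })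
  (λ { (distinct , formula) → let open FromFormula distinct formula
                                  open FromGeodesic walk shortest
                              in structure , vertex-last walk })
  where
    open PrimitiveIdempotents ℰ
    open Scheme 𝒳
    open Eigenvalues ℰ
    open PPolynomialCriterion P Q q P-trivial Q-trivial P-q Q-P P-*-P b c b≢0
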